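{- The Carlitz polynomials $\{G_j\}_{j\ge0}$ form an orthonormal basis of $C(O,K)$ if and only if the digit derivatives $\{D_j\}_{j\ge0}$ form an orthonormal basis of $C(O,K)$.
   Context: Let $q$ be a prime power, $K=\mathbf{F}_q((T))$, $O=\mathbf{F}_q[[T]]$, with absolute value $|x|=q^{ -v(x)}$ where $v$ is the $T$-adic valuation. $C(O,K)$ is the $K$-Banach space of continuous functions $O\to K$ with sup-norm $\|f\|=\max_{t\in O}|f(t)|$. A sequence $(f_n)_{n\ge0}$ in $C(O,K)$ is an orthonormal basis if every $f$ can be written uniquely as $f=\sum a_nf_n$ with $a_n\in K$, $a_n\to0$, and then $\|f\|=\max|a_n|$. For $n\ge1$ put $[n]=T^{q^n}-T$, $F_0=1$, $F_n=[n][n-1]^q\cdots[1]^{q^{n-1}}$, $e_n(x)=\prod_{m\in\mathbf{F}_q[T],\deg m<n}(x-m)$ (including $m=0$); $E_0(x)=x$, $E_n(x)=e_n(x)/F_n$ for $n\ge1$. Hasse derivatives: $\mathcal{D}_n(\sum_ia_iT^i)=\sum_i\binom{i}{n}a_iT^{i-n}$ (binomials read in $\mathbf{F}_q$). For $j\ge0$ with base-$q$ expansion $j=\alpha_0+\alpha_1q+\cdots+\alpha_sq^s$ ($0\le\alpha_i<q$), set $G_j(x)=\prod_{n=0}^sE_n(x)^{\alpha_n}$ and $D_j(x)=\prod_{n=0}^s\mathcal{D}_n(x)^{\alpha_n}$, with $G_0=D_0=1$. (The paper also writes $\mathcal{D}_j$ for the digit derivative $D_j$.) -}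

module Defs where

open import Level using (Level; _⊔_) renaming (suc to lsuc)
open import Algebra.Bundles using (CommutativeRing; RawRing)
import Algebra.Definitions.RawSemiring as RawSemiringOps
import Algebra.Properties.CommutativeMonoid.Sum as Sum
import Algebra.Properties.Ring as RingProperties
open import Data.Digit using (Expansion; toDigits)
open import Data.Empty using (⊥; ⊥-elim)
open import Data.Fin.Base using (Fin; zero; suc; toℕ; fromℕ<)
open import Data.Fin.Properties using (toℕ-fromℕ<; toℕ-injective; toℕ<n; punchInᵢ≢i)
import Data.Integer.Base as ℤ
open import Data.Integer.Base using (ℤ; +_)
open import Data.List.Base using (List; []; _∷_; map; foldr; allFin; cartesianProductWith)
open import Data.Nat.Base as ℕ using (ℕ; zero; suc; _≤_; _<_; z≤n; s≤s; _∸_)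
import Data.Nat.Properties as ℕₚ
open import Data.Nat.Combinatorics using (_C_)
open import Data.Nat.Primality using (Prime)
open import Data.Product.Base using (∃; ∃₂; _×_; _,_; proj₁; proj₂)
open import Data.Unit.Base using (⊤)
open import Data.Vec.Base using (Vec; []; _∷_)
open import Data.Vec.Functional using (Vector; removeAt)
open import Function.Base using (_∘_)
open import Function.Bundles using (Inverse; _⇔_)
open import Relation.Binary.PropositionalEquality as ≡ using (_≡_; _≢_)
open import Relation.Nullary.Decidable using (yes; no; fromWitness)
open import Relation.Binary.Definitions using (tri<; tri≈; tri>)

PrimePower : ℕ → Set
PrimePower q = ∃₂ λ p r → Prime p × 1 ≤ r × q ≡ p ℕ.^ r

-- A field with exactly q elements (up to its setoid equality).
record FiniteField (c ℓ : Level) (q : ℕ) : Set (lsuc (c ⊔ ℓ)) where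
  field
    commutativeRing : CommutativeRing c ℓ
  open CommutativeRing commutativeRing
  field
    0≉1         : 0# ≉ 1#
    inverse     : ∀ x → x ≉ 0# → ∃ λ y → x * y ≈ 1#
    enumeration : Inverse setoid (≡.setoid (Fin q))

module LocalField {c ℓ : Level} {q : ℕ} (𝔽 : FiniteField c ℓ q) where

  open FiniteField 𝔽 using (commutativeRing; 0≉1; inverse; enumeration)
  open CommutativeRing commutativeRing using (_≈_; _≉_; 0#; 1#; rawRing; +-commutativeMonoid) renaming (Carrier to F; _+_ to _+ꟳ_; _*_ to _*ꟳ_; -_ to -ꟳ_)
  open RawSemiringOps (RawRing.rawSemiring rawRing) using () renaming (_×_ to _×ꟳ_; sum to sumꟳ)
  private module 𝔽 = CommutativeRing commutativeRing

  -- O = F_q[[T]]; a series is its sequence of coefficients.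
  O : Set c
  O = ℕ → F

  infix 4 _≈ᴼ_
  _≈ᴼ_ : O → O → Set ℓ
  a ≈ᴼ b = ∀ i → a i ≈ b i

  constant : F → O
  constant x zero    = x
  constant x (suc _) = 0#

  infixl 6 _+ᴼ_ _-ᴼ_
  infixl 7 _*ᴼ_

  _+ᴼ_ : O → O → O
  (a +ᴼ b) i = a i +ꟳ b i

  -ᴼ_ : O → O
  (-ᴼ a) i = -ꟳ (a i)

  _-ᴼ_ : O → O → O
  a -ᴼ b = a +ᴼ (-ᴼ b)

  _*ᴼ_ : O → O → O
  (a *ᴼ b) n = sumꟳ {suc n} λ k → a (toℕ k) *ꟳ b (n ∸ toℕ k)

  0ᴼ 1ᴼ T : O
  0ᴼ _ = 0#
  1ᴼ   = constant 1#
  T 1  = 1#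
  T _  = 0#

  rawRingᴼ : RawRing c ℓ
  rawRingᴼ = record
    { Carrier = O ; _≈_ = _≈ᴼ_ ; _+_ = _+ᴼ_ ; _*_ = _*ᴼ_ ; -_ = -ᴼ_
    ; 0# = 0ᴼ ; 1# = 1ᴼ }

  open RawSemiringOps (RawRing.rawSemiring rawRingᴼ) using () renaming (_^_ to _^ᴼ_; sum to sumᴼ; product to productᴼ) public

  -- Multiplication by T ^ n.
  shift : ℕ → O → O
  shift zero    a         = a
  shift (suc n) a zero    = 0#
  shift (suc n) a (suc i) = shift n a i

  -- v(a) = i.
  HasOrder : O → ℕ → Set ℓ
  HasOrder a i = a i ≉ 0# × (∀ j → j < i → a j ≈ 0#)

  NonZeroᴼ : O → Set ℓ
  NonZeroᴼ a = ∃ (HasOrder a)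

  -- K = F_q((T)) = O[1/T]; the record stands for T^(-pole) · body.
  record K : Set c where
    constructor T^-_·_
    field
      pole : ℕ
      body : O
  open K public

  ι : O → K
  ι a = T^- 0 · a

  infix 4 _≈ᴷ_
  _≈ᴷ_ : K → K → Set ℓ
  x ≈ᴷ y = shift (pole y) (body x) ≈ᴼ shift (pole x) (body y)

  infixl 6 _+ᴷ_ _-ᴷ_
  infixl 7 _*ᴷ_

  _+ᴷ_ : K → K → K
  x +ᴷ y = T^- (pole x ℕ.+ pole y) · (shift (pole y) (body x) +ᴼ shift (pole x) (body y))

  -ᴷ_ : K → K
  -ᴷ x = T^- pole x · (-ᴼ body x)

  _-ᴷ_ : K → K → K
  x -ᴷ y = x +ᴷ (-ᴷ y)

  _*ᴷ_ : K → K → K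
  x *ᴷ y = T^- (pole x ℕ.+ pole y) · (body x *ᴼ body y)

  rawRingᴷ : RawRing c ℓ
  rawRingᴷ = record
    { Carrier = K ; _≈_ = _≈ᴷ_ ; _+_ = _+ᴷ_ ; _*_ = _*ᴷ_ ; -_ = -ᴷ_
    ; 0# = ι 0ᴼ ; 1# = ι 1ᴼ }

  open RawSemiringOps (RawRing.rawSemiring rawRingᴷ) using () renaming (_^_ to _^ᴷ_; sum to sumᴷ; product to productᴷ) public

  -- 1/a for nonzero a.  Write a = T^i · u with u(0) ≠ 0 and put
  -- w = 1 - u/u(0); then 1/u = (1/u(0)) · Σ_k w^k, and because w has no
  -- constant term only the summands with k ≤ n contribute to the n-th
  -- coefficient.
  recip : (a : O) → NonZeroᴼ a → K
  recip a (i , aᵢ≉0 , _) = T^- i · λ n → u₀⁻¹ *ꟳ sumᴼ {suc n} (λ k → w ^ᴼ toℕ k) n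
    where
    u₀⁻¹ : F
    u₀⁻¹ = proj₁ (inverse (a i) aᵢ≉0)
    w : O
    w = 1ᴼ -ᴼ constant u₀⁻¹ *ᴼ (λ n → a (i ℕ.+ n))

  -- The absolute value |x| = q^(-v(x)), with values in {0} ∪ q^ℤ.
  data Value : Set where
    𝟘    : Value
    q^-_ : ℤ → Value

  infix 4 _≤ⱽ_
  _≤ⱽ_ : Value → Value → Set
  𝟘      ≤ⱽ _      = ⊤
  q^- _  ≤ⱽ 𝟘      = ⊥
  q^- m  ≤ⱽ q^- n  = n ℤ.≤ m

  -- |x| = r is a relation because v(x) is not computable from x.
  infix 4 ∣_∣≐_ ∣_∣≤_
  ∣_∣≐_ : K → Value → Set ℓ
  ∣ x ∣≐ 𝟘     = x ≈ᴷ ι 0ᴼ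
  ∣ x ∣≐ q^- m = ∃ λ i → HasOrder (body x) i × (+ i ℤ.- + pole x) ≡ m

  ∣_∣≤_ : K → Value → Set ℓ
  ∣ x ∣≤ r = ∀ s → ∣ x ∣≐ s → s ≤ⱽ r

  -- max_i |u i| = r.
  IsMaxAbs : ∀ {i} {I : Set i} → (I → K) → Value → Set (i ⊔ ℓ)
  IsMaxAbs u r = (∃ λ i → ∣ u i ∣≐ r) × (∀ i → ∣ u i ∣≤ r)

  -- Membership in C(O,K).  Continuity at x applied to all y ≈ᴼ x shows that
  -- a continuous f automatically respects the equalities of O and K.
  Continuous : (O → K) → Set (c ⊔ ℓ)
  Continuous f = ∀ x (n : ℤ) → ∃ λ (m : ℤ) → ∀ y →
    ∣ ι x -ᴷ ι y ∣≤ q^- m → ∣ f x -ᴷ f y ∣≤ q^- n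

  TendsToZero : (ℕ → K) → Set ℓ
  TendsToZero a = ∀ (m : ℤ) → ∃ λ N → ∀ n → N ≤ n → ∣ a n ∣≤ q^- m

  -- f = Σ aₙ fₙ, the partial sums converging in the sup-norm.
  IsSum : (ℕ → O → K) → (ℕ → K) → (O → K) → Set (c ⊔ ℓ)
  IsSum fs a f = ∀ (m : ℤ) → ∃ λ N → ∀ n → N ≤ n → ∀ t →
    ∣ f t -ᴷ sumᴷ {n} (λ k → a (toℕ k) *ᴷ fs (toℕ k) t) ∣≤ q^- m

  IsExpansion : (ℕ → O → K) → (O → K) → (ℕ → K) → Set (c ⊔ ℓ)
  IsExpansion fs f a = TendsToZero a × IsSum fs a f

  -- The field norm says ‖f‖ = max |aₙ| by comparing the two maxima as
  -- relations; classically both exist (O is compact, aₙ → 0).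
  record IsOrthonormalBasis (fs : ℕ → O → K) : Set (c ⊔ ℓ) where
    field
      continuous : ∀ n → Continuous (fs n)
      expansion  : ∀ f → Continuous f → ∃ (IsExpansion fs f)
      unique     : ∀ f → Continuous f → ∀ a b →
                   IsExpansion fs f a →
                   IsExpansion fs f b → ∀ n → a n ≈ᴷ b n
      norm       : ∀ f → Continuous f → ∀ a →
                   IsExpansion fs f a →
                   ∀ r → IsMaxAbs f r ⇔ IsMaxAbs a r

  -- [n] and Fₙ = [n] [n-1]^q ⋯ [1]^(q^(n-1)), as elements of O.
  bracket : ℕ → O
  bracket n = T ^ᴼ (q ℕ.^ n) -ᴼ T

  Fᶜ : ℕ → O
  Fᶜ n = productᴼ {n} λ i → bracket (n ∸ toℕ i) ^ᴼ (q ℕ.^ toℕ i)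

  2≤q : 2 ≤ q
  2≤q = go enumeration
    where
    go : ∀ {q} → Inverse 𝔽.setoid (≡.setoid (Fin q)) → 2 ≤ q
    go {zero} e with Inverse.to e 0#
    ... | ()
    go {suc zero} e = ⊥-elim (0≉1 (𝔽.trans (𝔽.sym (Inverse.inverseʳ e (fin1 _ _))) (Inverse.inverseʳ e ≡.refl)))
      where
      fin1 : (i j : Fin 1) → i ≡ j
      fin1 zero zero = ≡.refl
    go {suc (suc q)} e = s≤s (s≤s z≤n)

  -- The lemmas up to Fᶜ-nonZero show that division by Fₙ is possible.
  open Sum +-commutativeMonoid using (sum-remove)

  sum-zero : ∀ {n} (t : Vector F n) → (∀ k → t k ≈ 0#) → sumꟳ t ≈ 0#
  sum-zero {zero}  t t≈0 = 𝔽.refl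
  sum-zero {suc n} t t≈0 = 𝔽.trans (𝔽.+-cong (t≈0 zero) (sum-zero (t ∘ suc) (t≈0 ∘ suc))) (𝔽.+-identityˡ 0#)

  sum-single : ∀ {n} (t : Vector F n) (k₀ : Fin n) → (∀ k → k ≢ k₀ → t k ≈ 0#) → sumꟳ t ≈ t k₀
  sum-single {suc n} t k₀ t≈0 = 𝔽.trans (sum-remove {i = k₀} t) (𝔽.trans
    (𝔽.+-congˡ (sum-zero (removeAt t k₀) λ k → t≈0 _ (punchInᵢ≢i k₀ k)))
    (𝔽.+-identityʳ (t k₀)))

  *-nonzero : ∀ {x y} → x ≉ 0# → y ≉ 0# → x *ꟳ y ≉ 0#
  *-nonzero {x} {y} x≉0 y≉0 xy≈0 = y≉0 (𝔽.trans (𝔽.sym (𝔽.*-identityˡ y)) (𝔽.trans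
    (𝔽.*-congʳ (𝔽.sym (𝔽.trans (𝔽.*-comm x⁻¹ x) xx⁻¹≈1))) (𝔽.trans
    (𝔽.*-assoc x⁻¹ x y) (𝔽.trans (𝔽.*-congˡ xy≈0) (𝔽.zeroʳ x⁻¹)))))
    where
    x⁻¹    = proj₁ (inverse x x≉0)
    xx⁻¹≈1 = proj₂ (inverse x x≉0)

  order-1 : HasOrder 1ᴼ 0
  order-1 = (λ 1≈0 → 0≉1 (𝔽.sym 1≈0)) , λ _ ()

  order-T : HasOrder T 1
  order-T = (λ 1≈0 → 0≉1 (𝔽.sym 1≈0)) , λ { zero _ → 𝔽.refl ; (suc _) (s≤s ()) }

  order-* : ∀ {a b i j} → HasOrder a i → HasOrder b j → HasOrder (a *ᴼ b) (i ℕ.+ j)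
  order-* {a} {b} {i} {j} (aᵢ≉0 , a-low) (bⱼ≉0 , b-low) = top , low
    where
    low-left : ∀ n k → k < i → a k *ꟳ b (n ∸ k) ≈ 0#
    low-left n k k<i = 𝔽.trans (𝔽.*-congʳ (a-low k k<i)) (𝔽.zeroˡ _)

    low-right : ∀ n k → n ∸ k < j → a k *ꟳ b (n ∸ k) ≈ 0#
    low-right n k n-k<j = 𝔽.trans (𝔽.*-congˡ (b-low (n ∸ k) n-k<j)) (𝔽.zeroʳ _)

    low : ∀ n → n < i ℕ.+ j → (a *ᴼ b) n ≈ 0#
    low n n<i+j = sum-zero (λ k → a (toℕ k) *ꟳ b (n ∸ toℕ k)) λ k → term (toℕ k) (ℕₚ.≤-pred (toℕ<n k))
      where
      term : ∀ k → k ≤ n → a k *ꟳ b (n ∸ k) ≈ 0#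
      term k k≤n with k ℕₚ.<? i
      ... | yes k<i = low-left n k k<i
      ... | no k≮i  = low-right n k (ℕₚ.+-cancelˡ-< k (n ∸ k) j
        (ℕₚ.<-≤-trans (≡.subst (_< i ℕ.+ j) (≡.sym (ℕₚ.m+[n∸m]≡n k≤n)) n<i+j)
          (ℕₚ.+-monoˡ-≤ j (ℕₚ.≮⇒≥ k≮i))))

    i<1+i+j : i < suc (i ℕ.+ j)
    i<1+i+j = s≤s (ℕₚ.m≤m+n i j)

    k₀ : Fin (suc (i ℕ.+ j))
    k₀ = fromℕ< i<1+i+j

    k₀≡i : toℕ k₀ ≡ i
    k₀≡i = toℕ-fromℕ< i<1+i+j

    product-at : Vector F (suc (i ℕ.+ j))
    product-at k = a (toℕ k) *ꟳ b (i ℕ.+ j ∸ toℕ k)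

    others : ∀ k → k ≢ k₀ → product-at k ≈ 0#
    others k k≢k₀ with ℕₚ.<-cmp (toℕ k) i
    ... | tri< k<i _ _ = low-left (i ℕ.+ j) (toℕ k) k<i
    ... | tri≈ _ k≡i _ = ⊥-elim (k≢k₀ (toℕ-injective (≡.trans k≡i (≡.sym k₀≡i))))
    ... | tri> _ _ i<k = low-right (i ℕ.+ j) (toℕ k) (≡.subst (i ℕ.+ j ∸ toℕ k <_) (ℕₚ.m+n∸m≡n i j)
      (ℕₚ.∸-monoʳ-< i<k (ℕₚ.≤-pred (toℕ<n k))))

    top : (a *ᴼ b) (i ℕ.+ j) ≉ 0#
    top ab≈0 = *-nonzero aᵢ≉0 bⱼ≉0 (𝔽.trans (𝔽.sym at-k₀) ab≈0)
      where
      at-k₀ : (a *ᴼ b) (i ℕ.+ j) ≈ a i *ꟳ b j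
      at-k₀ = 𝔽.trans (sum-single product-at k₀ others) (𝔽.reflexive (≡.cong₂ (λ k l → a k *ꟳ b l) k₀≡i
        (≡.trans (≡.cong (i ℕ.+ j ∸_) k₀≡i) (ℕₚ.m+n∸m≡n i j))))

  nonZero-^ : ∀ {a} → NonZeroᴼ a → ∀ n → NonZeroᴼ (a ^ᴼ n)
  nonZero-^ a≉0 zero    = 0 , order-1
  nonZero-^ a≉0 (suc n) = _ , order-* (proj₂ a≉0) (proj₂ (nonZero-^ a≉0 n))

  order-T^ : ∀ n → HasOrder (T ^ᴼ n) n
  order-T^ zero    = order-1
  order-T^ (suc n) = order-* order-T (order-T^ n)

  nonZero-product : ∀ {n} (u : Fin n → O) → (∀ k → NonZeroᴼ (u k)) → NonZeroᴼ (productᴼ u)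
  nonZero-product {zero}  u u≉0 = 0 , order-1
  nonZero-product {suc n} u u≉0 = _ , order-* (proj₂ (u≉0 zero)) (proj₂ (nonZero-product (u ∘ suc) (u≉0 ∘ suc)))

  2≤q^n : ∀ n → 1 ≤ n → 2 ≤ q ℕ.^ n
  2≤q^n (suc n) _ = ℕₚ.≤-trans 2≤q (ℕₚ.m≤m*n q (q ℕ.^ n) ⦃ ℕₚ.m^n≢0 q n ⦃ ℕ.>-nonZero (ℕₚ.<-trans (s≤s z≤n) 2≤q) ⦄ ⦄)

  nonZero-bracket : ∀ n → 1 ≤ n → NonZeroᴼ (bracket n)
  nonZero-bracket n 1≤n = 1 , top , low
    where
    open RingProperties 𝔽.ring using (-0#≈0#; -‿injective)
    T^-low : ∀ i → i < 2 → (T ^ᴼ (q ℕ.^ n)) i ≈ 0#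
    T^-low i i<2 = proj₂ (order-T^ (q ℕ.^ n)) i (ℕₚ.<-≤-trans i<2 (2≤q^n n 1≤n))
    top : bracket n 1 ≉ 0#
    top eq = 0≉1 (𝔽.sym (-‿injective (𝔽.trans (𝔽.sym (𝔽.+-identityˡ _))
      (𝔽.trans (𝔽.+-congʳ (𝔽.sym (T^-low 1 (s≤s (s≤s z≤n))))) (𝔽.trans eq (𝔽.sym -0#≈0#))))))
    low : ∀ i → i < 1 → bracket n i ≈ 0#
    low zero _ = 𝔽.trans (𝔽.+-cong (T^-low 0 (s≤s z≤n)) -0#≈0#) (𝔽.+-identityˡ 0#)
    low (suc _) (s≤s ())

  Fᶜ-nonZero : ∀ n → NonZeroᴼ (Fᶜ n)
  Fᶜ-nonZero n = nonZero-product _ λ i →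
    nonZero-^ (nonZero-bracket (n ∸ toℕ i) (ℕₚ.m<n⇒0<n∸m (toℕ<n i))) (q ℕ.^ toℕ i)

  -- The polynomials of degree < n are the coefficient vectors of length n,
  -- constant term first.
  polynomial : ∀ {n} → Vec F n → O
  polynomial []       _       = 0#
  polynomial (x ∷ xs) zero    = x
  polynomial (x ∷ xs) (suc i) = polynomial xs i

  elements : List F
  elements = map (Inverse.from enumeration) (allFin q)

  vectors : ∀ n → List (Vec F n)
  vectors zero    = [] ∷ []
  vectors (suc n) = cartesianProductWith _∷_ elements (vectors n)

  e : ℕ → O → O
  e n x = foldr (λ m acc → (x -ᴼ polynomial m) *ᴼ acc) 1ᴼ (vectors n)

  E : ℕ → O → K
  E zero      x = ι x
  E n@(suc _) x = ι (e n x) *ᴷ recip (Fᶜ n) (Fᶜ-nonZero n)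

  𝒟 : ℕ → O → O
  𝒟 n a i = ((i ℕ.+ n) C n) ×ꟳ a (i ℕ.+ n)

  -- digitProduct u n [α₀,…,αₛ] x = uₙ(x)^α₀ ⋯ uₙ₊ₛ(x)^αₛ.
  digitProduct : (ℕ → O → K) → ℕ → Expansion q → O → K
  digitProduct u n []       x = ι 1ᴼ
  digitProduct u n (α ∷ αs) x = (u n x ^ᴷ toℕ α) *ᴷ digitProduct u (suc n) αs x

  digits : ℕ → Expansion q
  digits j = proj₁ (toDigits q {fromWitness 2≤q} j)

  G : ℕ → O → K
  G j = digitProduct E 0 (digits j)

  D : ℕ → O → K
  D j = digitProduct (λ n x → ι (𝒟 n x)) 0 (digits j)

{-# OPTIONS --safe #-}

-- For x = Σ xₙ Tⁿ in O, both Eₙ(x) and 𝒟ₙ(x) are integral with residue xₙ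
-- modulo T.  For 𝒟ₙ this is (n choose n) = 1.  For Eₙ, compare leading terms:
-- eₙ(x) and Fₙ xₙ agree modulo T^(1 + v(Fₙ)), where Wilson's theorem evaluates
-- the product of the leading coefficients of the factors x - m.  Hence Gⱼ and Dⱼ
-- are integral and ‖Gⱼ - Dⱼ‖ < 1, and orthonormality is stable under such a
-- perturbation: expanding f in one family and replacing the functions by those
-- of the other leaves an error of norm at most ‖f‖ / q, and one iterates.
module Submission where

open import Defs
open import Data.Nat.Base using (ℕ)
open import Function.Bundles using (_⇔_)
open import Level using (Level)

open import Algebra.Bundles using (CommutativeMonoid; CommutativeRing; RawRing)
import Algebra.Construct.DirectProduct as DirectProduct
import Algebra.Definitions.RawSemiring as RawSemiringOps
import Algebra.Properties.CommutativeMonoid.Mult as Mult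
import Algebra.Properties.CommutativeMonoid.Sum as Sum
import Algebra.Properties.CommutativeSemigroup as CommutativeSemigroupProperties
import Algebra.Properties.Ring as RingProperties
open import Data.Digit using (Expansion)
open import Data.Empty using (⊥-elim)
open import Data.Fin.Base using (Fin; zero; suc; toℕ)
import Data.Fin.Properties as Finₚ
import Data.Integer.Base as ℤ
open import Data.Integer.Base using (ℤ; +_; -[1+_])
import Data.Integer.Properties as ℤₚ
open import Data.Integer.Tactic.RingSolver using (solve-∀)
open import Data.List.Base using (List; []; _∷_; _++_; length; map; foldr; cartesianProductWith; allFin)
open import Data.List.Membership.Propositional.Properties using (∈-allFin)
import Data.List.Membership.Setoid as Membership
open import Data.List.Membership.Setoid.Properties using (∈-map⁺; ∈-map⁻; ∈-resp-≈; All[≉]⇒∉)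
import Data.List.Properties as Listₚ
import Data.List.Relation.Binary.Permutation.Setoid as Permutation
import Data.List.Relation.Binary.Permutation.Setoid.Properties as Permutationₚ
open import Data.List.Relation.Unary.All as All using (All; []; _∷_)
open import Data.List.Relation.Unary.AllPairs using ([]; _∷_)
open import Data.List.Relation.Unary.Any using (here; there)
import Data.List.Relation.Unary.Unique.Propositional.Properties as Unique≡ₚ
import Data.List.Relation.Unary.Unique.Setoid as UniqueSetoid
import Data.List.Relation.Unary.Unique.Setoid.Properties as Uniqueₚ
open import Data.Nat.Base as ℕ using (zero; suc; _≤_; _<_; z≤n; s≤s; _∸_; _⊔_)
open import Data.Nat.Combinatorics using (_C_; nCn≡1)
import Data.Nat.Properties as ℕₚ
open import Data.Product.Base using (∃; _×_; _,_; proj₁; proj₂)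
open import Data.Sum.Base using (_⊎_; inj₁; inj₂; [_,_]′)
open import Data.Unit.Base using (tt)
open import Data.Vec.Base using (Vec; []; _∷_)
open import Function.Base using (_∘_)
open import Function.Bundles using (Equivalence; Inverse; mk⇔)
import Level
open import Relation.Binary.PropositionalEquality as ≡ using (_≡_)
import Relation.Binary.Reasoning.Setoid as SetoidReasoning
open import Relation.Nullary.Decidable using (Dec; yes; no; map′)
open import Relation.Nullary.Negation using (contradiction)

-- The obstacle is that the order of a series cannot be computed from its coefficients, so a maximum
-- of absolute values cannot simply be chosen. Absolute values are therefore translated at once into
-- vanishing of coefficients: |x| ≤ q^(-m) becomes `Below x m`. A maximum is extracted only from a
-- null sequence, where at each index finitely many entries matter and equality in a finite field is
-- decidable. A continuous function gets its maximum by transfer from its coefficient sequence, and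
-- the bound on f that starts the iteration is read off from the expansion of f in the given basis.
-- Each round of the iteration fixes one more T-adic coefficient of every expansion coefficient, so
-- the limit can be written down coefficient by coefficient.

module _ {c ℓ : Level} {q : ℕ} (𝔽 : FiniteField c ℓ q) where

  open LocalField 𝔽
  open FiniteField 𝔽 using (commutativeRing; 0≉1; inverse; enumeration)
  open CommutativeRing commutativeRing using (_≈_; _≉_; 0#; 1#; rawRing) renaming (Carrier to F; _+_ to _+ꟳ_; _*_ to _*ꟳ_; -_ to -ꟳ_)
  private module 𝔽 = CommutativeRing commutativeRing
  open RawSemiringOps (RawRing.rawSemiring rawRing) using () renaming (_×_ to _×ꟳ_; sum to sumꟳ; _^_ to _^ꟳ_)
  open RingProperties 𝔽.ring using (-0#≈0#; -‿distribˡ-*; -‿distribʳ-*; -‿+-comm; -‿injective; -‿involutive; x≈y⇒x∙y⁻¹≈ε; x∙y⁻¹≈ε⇒x≈y; +-inverseˡ-unique; +-cancelˡ)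
  open Sum 𝔽.+-commutativeMonoid using (sum-cong-≋; ∑-distrib-+)
  open Membership 𝔽.setoid using (_∈_)
  open Permutation 𝔽.setoid using (_↭_; prep; swap; ↭-refl; ↭-sym; ↭-trans)
  open Permutationₚ 𝔽.setoid using (∈-resp-↭; Unique-resp-↭; xs↭ys⇒|xs|≡|ys|; foldr-commMonoid)
  open UniqueSetoid 𝔽.setoid using (Unique)

  infix 4 _≟ꟳ_
  -- Decided through the indices in `Fin q`. All searches for non-zero coefficients below rest on
  -- this.
  _≟ꟳ_ : (x y : F) → Dec (x ≈ y)
  x ≟ꟳ y = map′ from-≡ (Inverse.to-cong enumeration) (Inverse.to enumeration x Finₚ.≟ Inverse.to enumeration y)
    where
    from-≡ : Inverse.to enumeration x ≡ Inverse.to enumeration y → x ≈ y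
    from-≡ eq = 𝔽.trans (𝔽.sym (Inverse.strictlyInverseʳ enumeration x)) (Inverse.inverseʳ enumeration eq)

  i+j-j≡i : ∀ i j → i ℤ.+ j ℤ.- j ≡ i
  i+j-j≡i = solve-∀

  i-j+j≡i : ∀ i j → i ℤ.- j ℤ.+ j ≡ i
  i-j+j≡i = solve-∀

  -- Coefficients of elements of K

  at : O → ℤ → F
  at b (+ j)    = b j
  at b -[1+ _ ] = 0#

  -- The coefficient of T^z. A pair of pole and body is not determined by the element of K it stands
  -- for, but these coefficients are, so arguments about them need no common denominator.
  coef : K → ℤ → F
  coef x z = at (body x) (z ℤ.+ + pole x)

  at-cong : ∀ {a b} → a ≈ᴼ b → ∀ s → at a s ≈ at b s
  at-cong a≈b (+ j)    = a≈b j
  at-cong a≈b -[1+ _ ] = 𝔽.refl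

  at-0 : ∀ s → at 0ᴼ s ≈ 0#
  at-0 (+ _)    = 𝔽.refl
  at-0 -[1+ _ ] = 𝔽.refl

  at-+ : ∀ a b s → at (a +ᴼ b) s ≈ at a s +ꟳ at b s
  at-+ a b (+ j)    = 𝔽.refl
  at-+ a b -[1+ _ ] = 𝔽.sym (𝔽.+-identityˡ 0#)

  at-neg : ∀ a s → at (-ᴼ a) s ≈ -ꟳ at a s
  at-neg a (+ j)    = 𝔽.refl
  at-neg a -[1+ _ ] = 𝔽.sym -0#≈0#

  shift-cong : ∀ r {a b} → a ≈ᴼ b → shift r a ≈ᴼ shift r b
  shift-cong zero    a≈b i       = a≈b i
  shift-cong (suc r) a≈b zero    = 𝔽.refl
  shift-cong (suc r) a≈b (suc i) = shift-cong r a≈b i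

  shift-suc : ∀ r a → shift (suc r) a ≈ᴼ shift 1 (shift r a)
  shift-suc r a zero    = 𝔽.refl
  shift-suc r a (suc i) = 𝔽.refl

  at-shift₁ : ∀ b s → at (shift 1 b) (ℤ.suc s) ≈ at b s
  at-shift₁ b (+ j)        = 𝔽.refl
  at-shift₁ b -[1+ zero ]  = 𝔽.refl
  at-shift₁ b -[1+ suc k ] = 𝔽.refl

  at-shift : ∀ r b s → at (shift r b) (s ℤ.+ + r) ≈ at b s
  at-shift zero    b s = 𝔽.reflexive (≡.cong (at b) (ℤₚ.+-identityʳ s))
  at-shift (suc r) b s = 𝔽.trans (at-cong (shift-suc r b) (s ℤ.+ + suc r)) (𝔽.trans
    (𝔽.reflexive (≡.cong (at (shift 1 (shift r b))) (eq s (+ r))))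
    (𝔽.trans (at-shift₁ (shift r b) (s ℤ.+ + r)) (at-shift r b s)))
    where
    eq : ∀ s r → s ℤ.+ (ℤ.+ 1 ℤ.+ r) ≡ ℤ.+ 1 ℤ.+ (s ℤ.+ r)
    eq = solve-∀

  coef-shift : ∀ p r b z → coef (T^- (p ℕ.+ r) · shift r b) z ≈ coef (T^- p · b) z
  coef-shift p r b z = 𝔽.trans (𝔽.reflexive (≡.cong (at (shift r b)) (≡.sym (ℤₚ.+-assoc z (+ p) (+ r)))))
    (at-shift r b (z ℤ.+ + p))

  coef-pole : ∀ {p r} b z → p ≡ r → coef (T^- p · b) z ≈ coef (T^- r · b) z
  coef-pole b z ≡.refl = 𝔽.refl

  coef-ι0 : ∀ z → coef (ι 0ᴼ) z ≈ 0#
  coef-ι0 z = at-0 (z ℤ.+ + 0)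

  coef-+ : ∀ x y z → coef (x +ᴷ y) z ≈ coef x z +ꟳ coef y z
  coef-+ x y z = 𝔽.trans (at-+ (shift (pole y) (body x)) (shift (pole x) (body y)) (z ℤ.+ + (pole x ℕ.+ pole y)))
    (𝔽.+-cong (coef-shift (pole x) (pole y) (body x) z)
      (𝔽.trans (coef-pole _ z (ℕₚ.+-comm (pole x) (pole y))) (coef-shift (pole y) (pole x) (body y) z)))

  coef-neg : ∀ x z → coef (-ᴷ x) z ≈ -ꟳ coef x z
  coef-neg x z = at-neg (body x) (z ℤ.+ + pole x)

  coef-sub : ∀ x y z → coef (x -ᴷ y) z ≈ coef x z 𝔽.- coef y z
  coef-sub x y z = 𝔽.trans (coef-+ x (-ᴷ y) z) (𝔽.+-congˡ (coef-neg y z))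

  coef-sum : ∀ {n} (u : Fin n → K) z → coef (sumᴷ u) z ≈ sumꟳ (λ k → coef (u k) z)
  coef-sum {zero}  u z = coef-ι0 z
  coef-sum {suc n} u z = 𝔽.trans (coef-+ (u zero) (sumᴷ (u ∘ suc)) z) (𝔽.+-congˡ (coef-sum (u ∘ suc) z))

  body-coef : ∀ x i → body x i ≈ coef x (+ i ℤ.- + pole x)
  body-coef x i = 𝔽.reflexive (≡.cong (at (body x)) (≡.sym (i-j+j≡i (+ i) (+ pole x))))

  infix 4 _≋_
  _≋_ : K → K → Set ℓ
  x ≋ y = ∀ z → coef x z ≈ coef y z

  ≋⇒≈ᴷ : ∀ {x y} → x ≋ y → x ≈ᴷ y
  ≋⇒≈ᴷ {x} {y} x≋y i = 𝔽.trans (body-coef (T^- (pole x ℕ.+ pole y) · shift (pole y) (body x)) i) (𝔽.trans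
    (𝔽.trans (coef-shift (pole x) (pole y) (body x) z) (𝔽.trans (x≋y z)
      (𝔽.trans (𝔽.sym (coef-shift (pole y) (pole x) (body y) z)) (coef-pole _ z (ℕₚ.+-comm (pole y) (pole x))))))
    (𝔽.sym (body-coef (T^- (pole x ℕ.+ pole y) · shift (pole x) (body y)) i)))
    where
    z = + i ℤ.- + (pole x ℕ.+ pole y)

  -- The form of congruence that continuity of `e n` requires: coefficient n of a product sees only
  -- coefficients up to n of the factors.
  *ᴼ-cong-below : ∀ {a a′ b b′} n → (∀ i → i ≤ n → a i ≈ a′ i) → (∀ i → i ≤ n → b i ≈ b′ i) → (a *ᴼ b) n ≈ (a′ *ᴼ b′) n
  *ᴼ-cong-below n a≈ b≈ = sum-cong-≋ {suc n} λ k →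
    𝔽.*-cong (a≈ (toℕ k) (ℕₚ.≤-pred (Finₚ.toℕ<n k))) (b≈ (n ∸ toℕ k) (ℕₚ.m∸n≤m n (toℕ k)))

  *ᴼ-cong : ∀ {a a′ b b′} → a ≈ᴼ a′ → b ≈ᴼ b′ → a *ᴼ b ≈ᴼ a′ *ᴼ b′
  *ᴼ-cong a≈ b≈ n = *ᴼ-cong-below n (λ i _ → a≈ i) (λ i _ → b≈ i)

  *ᴼ-distribʳ : ∀ w a b → (a +ᴼ b) *ᴼ w ≈ᴼ a *ᴼ w +ᴼ b *ᴼ w
  *ᴼ-distribʳ w a b n = 𝔽.trans
    (sum-cong-≋ {suc n} λ k → 𝔽.distribʳ (w (n ∸ toℕ k)) (a (toℕ k)) (b (toℕ k)))
    (∑-distrib-+ {suc n} (λ k → a (toℕ k) *ꟳ w (n ∸ toℕ k)) (λ k → b (toℕ k) *ꟳ w (n ∸ toℕ k)))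

  *ᴼ-distribˡ : ∀ w a b → w *ᴼ (a +ᴼ b) ≈ᴼ w *ᴼ a +ᴼ w *ᴼ b
  *ᴼ-distribˡ w a b n = 𝔽.trans
    (sum-cong-≋ {suc n} λ k → 𝔽.distribˡ (w (toℕ k)) (a (n ∸ toℕ k)) (b (n ∸ toℕ k)))
    (∑-distrib-+ {suc n} (λ k → w (toℕ k) *ꟳ a (n ∸ toℕ k)) (λ k → w (toℕ k) *ꟳ b (n ∸ toℕ k)))

  sum-neg : ∀ {n} (t : Fin n → F) → sumꟳ (λ k → -ꟳ t k) ≈ -ꟳ sumꟳ t
  sum-neg {zero}  t = 𝔽.sym -0#≈0#
  sum-neg {suc n} t = 𝔽.trans (𝔽.+-congˡ (sum-neg (t ∘ suc))) (-‿+-comm _ _)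

  *ᴼ-negˡ : ∀ a b → (-ᴼ a) *ᴼ b ≈ᴼ -ᴼ (a *ᴼ b)
  *ᴼ-negˡ a b n = 𝔽.trans
    (sum-cong-≋ {suc n} λ k → 𝔽.sym (-‿distribˡ-* (a (toℕ k)) (b (n ∸ toℕ k))))
    (sum-neg {suc n} (λ k → a (toℕ k) *ꟳ b (n ∸ toℕ k)))

  *ᴼ-negʳ : ∀ a b → a *ᴼ (-ᴼ b) ≈ᴼ -ᴼ (a *ᴼ b)
  *ᴼ-negʳ a b n = 𝔽.trans
    (sum-cong-≋ {suc n} λ k → 𝔽.sym (-‿distribʳ-* (a (toℕ k)) (b (n ∸ toℕ k))))
    (sum-neg {suc n} (λ k → a (toℕ k) *ꟳ b (n ∸ toℕ k)))

  0*+ : ∀ x y → 0# *ꟳ x +ꟳ y ≈ y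
  0*+ x y = 𝔽.trans (𝔽.+-congʳ (𝔽.zeroˡ x)) (𝔽.+-identityˡ y)

  *0+ : ∀ x y → x *ꟳ 0# +ꟳ y ≈ y
  *0+ x y = 𝔽.trans (𝔽.+-congʳ (𝔽.zeroʳ x)) (𝔽.+-identityˡ y)

  shift₁-*ˡ : ∀ a b → shift 1 a *ᴼ b ≈ᴼ shift 1 (a *ᴼ b)
  shift₁-*ˡ a b zero    = 0*+ (b 0) 0#
  shift₁-*ˡ a b (suc n) = 0*+ (b (suc n)) _

  shift₁-*ʳ : ∀ a b → a *ᴼ shift 1 b ≈ᴼ shift 1 (a *ᴼ b)
  shift₁-*ʳ a b zero          = *0+ (a 0) 0#
  shift₁-*ʳ a b (suc zero)    = 𝔽.+-congˡ (*0+ (a 1) 0#)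
  shift₁-*ʳ a b (suc (suc n)) = 𝔽.+-congˡ (shift₁-*ʳ (a ∘ suc) b (suc n))

  shift-*ˡ : ∀ r a b → shift r a *ᴼ b ≈ᴼ shift r (a *ᴼ b)
  shift-*ˡ zero    a b i = 𝔽.refl
  shift-*ˡ (suc r) a b i = 𝔽.trans (*ᴼ-cong {b = b} (shift-suc r a) (λ _ → 𝔽.refl) i) (𝔽.trans (shift₁-*ˡ (shift r a) b i)
    (𝔽.trans (shift-cong 1 (shift-*ˡ r a b) i) (𝔽.sym (shift-suc r (a *ᴼ b) i))))

  shift-*ʳ : ∀ r a b → a *ᴼ shift r b ≈ᴼ shift r (a *ᴼ b)
  shift-*ʳ zero    a b i = 𝔽.refl
  shift-*ʳ (suc r) a b i = 𝔽.trans (*ᴼ-cong {a} (λ _ → 𝔽.refl) (shift-suc r b) i) (𝔽.trans (shift₁-*ʳ a (shift r b) i)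
    (𝔽.trans (shift-cong 1 (shift-*ʳ r a b) i) (𝔽.sym (shift-suc r (a *ᴼ b) i))))

  +-swap₂₃ : ∀ m n o → (m ℕ.+ n) ℕ.+ o ≡ (m ℕ.+ o) ℕ.+ n
  +-swap₂₃ m n o = ≡.trans (ℕₚ.+-assoc m n o) (≡.trans (≡.cong (m ℕ.+_) (ℕₚ.+-comm n o)) (≡.sym (ℕₚ.+-assoc m o n)))

  -- The two sides of the distributive law carry different poles, since `w` enters twice on the
  -- right. Comparing coefficients absorbs the resulting shifts.
  coef-distribʳ : ∀ w x y z → coef ((x +ᴷ y) *ᴷ w) z ≈ coef (x *ᴷ w) z +ꟳ coef (y *ᴷ w) z
  coef-distribʳ w x y z = 𝔽.trans (at-cong (λ i → 𝔽.trans (*ᴼ-distribʳ (body w) (shift (pole y) (body x)) (shift (pole x) (body y)) i)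
      (𝔽.+-cong (shift-*ˡ (pole y) (body x) (body w) i) (shift-*ˡ (pole x) (body y) (body w) i))) s)
    (𝔽.trans (at-+ (shift (pole y) (body x *ᴼ body w)) (shift (pole x) (body y *ᴼ body w)) s)
    (𝔽.+-cong
      (𝔽.trans (coef-pole _ z (+-swap₂₃ (pole x) (pole y) (pole w))) (coef-shift _ (pole y) (body x *ᴼ body w) z))
      (𝔽.trans (coef-pole _ z (≡.trans (≡.cong (ℕ._+ pole w) (ℕₚ.+-comm (pole x) (pole y))) (+-swap₂₃ (pole y) (pole x) (pole w))))
        (coef-shift _ (pole x) (body y *ᴼ body w) z))))
    where
    s = z ℤ.+ + (pole x ℕ.+ pole y ℕ.+ pole w)

  coef-distribˡ : ∀ w x y z → coef (w *ᴷ (x +ᴷ y)) z ≈ coef (w *ᴷ x) z +ꟳ coef (w *ᴷ y) z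
  coef-distribˡ w x y z = 𝔽.trans (at-cong (λ i → 𝔽.trans (*ᴼ-distribˡ (body w) (shift (pole y) (body x)) (shift (pole x) (body y)) i)
      (𝔽.+-cong (shift-*ʳ (pole y) (body w) (body x) i) (shift-*ʳ (pole x) (body w) (body y) i))) s)
    (𝔽.trans (at-+ (shift (pole y) (body w *ᴼ body x)) (shift (pole x) (body w *ᴼ body y)) s)
    (𝔽.+-cong
      (𝔽.trans (coef-pole _ z (≡.sym (ℕₚ.+-assoc (pole w) (pole x) (pole y)))) (coef-shift _ (pole y) (body w *ᴼ body x) z))
      (𝔽.trans (coef-pole _ z (≡.trans (≡.sym (ℕₚ.+-assoc (pole w) (pole x) (pole y))) (+-swap₂₃ (pole w) (pole x) (pole y))))
        (coef-shift _ (pole x) (body w *ᴼ body y) z))))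
    where
    s = z ℤ.+ + (pole w ℕ.+ (pole x ℕ.+ pole y))

  coef-subʳ : ∀ w x y z → coef ((x -ᴷ y) *ᴷ w) z ≈ coef (x *ᴷ w) z 𝔽.- coef (y *ᴷ w) z
  coef-subʳ w x y z = 𝔽.trans (coef-distribʳ w x (-ᴷ y) z) (𝔽.+-congˡ
    (𝔽.trans (at-cong (*ᴼ-negˡ (body y) (body w)) (z ℤ.+ + (pole y ℕ.+ pole w))) (coef-neg (y *ᴷ w) z)))

  coef-subˡ : ∀ w x y z → coef (w *ᴷ (x -ᴷ y)) z ≈ coef (w *ᴷ x) z 𝔽.- coef (w *ᴷ y) z
  coef-subˡ w x y z = 𝔽.trans (coef-distribˡ w x (-ᴷ y) z) (𝔽.+-congˡ
    (𝔽.trans (at-cong (*ᴼ-negʳ (body w) (body y)) (z ℤ.+ + (pole w ℕ.+ pole y))) (coef-neg (w *ᴷ y) z)))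

  -- Vanishing of low coefficients and congruences modulo powers of T

  Low : O → ℕ → Set ℓ
  Low a i = ∀ j → j < i → a j ≈ 0#

  low-* : ∀ i {j} {a b} → Low a i → Low b j → Low (a *ᴼ b) (i ℕ.+ j)
  low-* zero    {j} {a} {b} a-low b-low n n<j = sum-zero {suc n} _ λ k →
    𝔽.trans (𝔽.*-congˡ (b-low (n ∸ toℕ k) (ℕₚ.≤-<-trans (ℕₚ.m∸n≤m n (toℕ k)) n<j))) (𝔽.zeroʳ (a (toℕ k)))
  low-* (suc i) {j} {a} {b} a-low b-low zero    _           = 𝔽.trans (𝔽.+-congʳ (𝔽.*-congʳ (a-low 0 (s≤s z≤n)))) (0*+ (b 0) 0#)
  low-* (suc i) {j} {a} {b} a-low b-low (suc n) (s≤s n<i+j) = 𝔽.trans (𝔽.+-congʳ (𝔽.*-congʳ (a-low 0 (s≤s z≤n)))) (𝔽.trans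
    (0*+ (b (suc n)) _) (low-* i (λ j j<i → a-low (suc j) (s≤s j<i)) b-low n n<i+j))

  -- Only the term k = i of the convolution survives. The induction strips vanishing constant terms
  -- from `a`, so the claim also covers leading coefficients that are zero.
  top-* : ∀ i {j} {a b} → Low a i → Low b j → (a *ᴼ b) (i ℕ.+ j) ≈ a i *ꟳ b j
  top-* zero    {zero}  {a} {b} a-low b-low = 𝔽.+-identityʳ _
  top-* zero    {suc j} {a} {b} a-low b-low = 𝔽.trans (𝔽.+-congˡ (sum-zero {suc j} _ λ k →
    𝔽.trans (𝔽.*-congˡ (b-low (j ∸ toℕ k) (s≤s (ℕₚ.m∸n≤m j (toℕ k))))) (𝔽.zeroʳ (a (suc (toℕ k)))))) (𝔽.+-identityʳ _)
  top-* (suc i) {j} {a} {b} a-low b-low = 𝔽.trans (𝔽.+-congʳ (𝔽.*-congʳ (a-low 0 (s≤s z≤n)))) (𝔽.trans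
    (0*+ (b (suc (i ℕ.+ j))) _) (top-* i (λ j j<i → a-low (suc j) (s≤s j<i)) b-low))

  infix 4 _≈_below_
  -- Congruence modulo T^m, that is |x - y| ≤ q^(-m), stated without forming the difference.
  _≈_below_ : K → K → ℤ → Set ℓ
  x ≈ y below m = ∀ z → z ℤ.< m → coef x z ≈ coef y z

  Below : K → ℤ → Set ℓ
  Below x m = ∀ z → z ℤ.< m → coef x z ≈ 0#

  below⇒zero : ∀ x m → Below x m → ∀ j → + j ℤ.< m ℤ.+ + pole x → body x j ≈ 0#
  below⇒zero x m x<m j j<m+p = 𝔽.trans (body-coef x j) (x<m (+ j ℤ.- + pole x)
    (≡.subst (+ j ℤ.- + pole x ℤ.<_) (i+j-j≡i m (+ pole x)) (ℤₚ.+-monoˡ-< (ℤ.- + pole x) j<m+p)))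

  -- A body has no coefficients of negative index, so `m + pole x` is cut off at 0. Hence the
  -- inequality in place of an equation.
  Below⇒Low : ∀ x m → Below x m → ∃ λ i → Low (body x) i × m ℤ.+ + pole x ℤ.≤ + i
  Below⇒Low x m x<m with m ℤ.+ + pole x | below⇒zero x m x<m
  ... | -[1+ _ ] | _      = 0 , (λ _ ()) , ℤ.-≤+
  ... | + i      | x-zero = i , (λ j j<i → x-zero j (ℤ.+<+ j<i)) , ℤₚ.≤-refl

  Low⇒Below : ∀ x m i → Low (body x) i → m ℤ.+ + pole x ℤ.≤ + i → Below x m
  Low⇒Below x m i low m+p≤i z z<m with z ℤ.+ + pole x | ℤₚ.<-≤-trans (ℤₚ.+-monoˡ-< (+ pole x) z<m) m+p≤i
  ... | + j      | ℤ.+<+ j<i = low j j<i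
  ... | -[1+ _ ] | _         = 𝔽.refl

  below-* : ∀ x y m n → Below x m → Below y n → Below (x *ᴷ y) (m ℤ.+ n)
  below-* x y m n x<m y<n with Below⇒Low x m x<m | Below⇒Low y n y<n
  ... | i , x-low , m≤i | j , y-low , n≤j = Low⇒Below (x *ᴷ y) (m ℤ.+ n) (i ℕ.+ j) (low-* i x-low y-low)
    (≡.subst (ℤ._≤ + (i ℕ.+ j)) (eq m n (+ pole x) (+ pole y)) (ℤₚ.+-mono-≤ m≤i n≤j))
    where
    eq : ∀ m n p r → (m ℤ.+ p) ℤ.+ (n ℤ.+ r) ≡ (m ℤ.+ n) ℤ.+ (p ℤ.+ r)
    eq = solve-∀

  below-pole : ∀ x → Below x (ℤ.- + pole x)
  below-pole x = Low⇒Below x _ 0 (λ _ ()) (ℤₚ.≤-reflexive (ℤₚ.+-inverseˡ (+ pole x)))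

  ≈below⇒sub : ∀ x y m → x ≈ y below m → Below (x -ᴷ y) m
  ≈below⇒sub x y m x≈y z z<m = 𝔽.trans (coef-sub x y z) (x≈y⇒x∙y⁻¹≈ε (x≈y z z<m))

  sub⇒≈below : ∀ x y m → Below (x -ᴷ y) m → x ≈ y below m
  sub⇒≈below x y m x-y z z<m = x∙y⁻¹≈ε⇒x≈y _ _ (𝔽.trans (𝔽.sym (coef-sub x y z)) (x-y z z<m))

  *-congˡ-below : ∀ w x y m n → Below w m → x ≈ y below n → w *ᴷ x ≈ w *ᴷ y below (m ℤ.+ n)
  *-congˡ-below w x y m n w<m x≈y z z< = x∙y⁻¹≈ε⇒x≈y _ _ (𝔽.trans (𝔽.sym (coef-subˡ w x y z))
    (below-* w (x -ᴷ y) m n w<m (≈below⇒sub x y n x≈y) z z<))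

  *-congʳ-below : ∀ w x y m n → Below w n → x ≈ y below m → x *ᴷ w ≈ y *ᴷ w below (m ℤ.+ n)
  *-congʳ-below w x y m n w<n x≈y z z< = x∙y⁻¹≈ε⇒x≈y _ _ (𝔽.trans (𝔽.sym (coef-subʳ w x y z))
    (below-* (x -ᴷ y) w m n (≈below⇒sub x y m x≈y) w<n z z<))

  -- Absolute values and maxima

  value⇒coef : ∀ x m → ∣ x ∣≐ q^- m → coef x m ≉ 0# × Below x m
  value⇒coef x m (i , (xᵢ≉0 , low) , ≡.refl) = (λ eq → xᵢ≉0 (𝔽.trans (body-coef x i) eq)) ,
    Low⇒Below x _ i low (ℤₚ.≤-reflexive (i-j+j≡i (+ i) (+ pole x)))

  coef⇒value : ∀ x m → coef x m ≉ 0# → Below x m → ∣ x ∣≐ q^- m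
  coef⇒value x m cₘ≉0 x<m with m ℤ.+ + pole x in eq | below⇒zero x m x<m
  ... | -[1+ _ ] | _      = contradiction 𝔽.refl cₘ≉0
  ... | + i      | x-zero = i , (cₘ≉0 , λ j j<i → x-zero j (ℤ.+<+ j<i)) ,
    ≡.trans (≡.cong (ℤ._- + pole x) (≡.sym eq)) (i+j-j≡i m (+ pole x))

  coef⇒zero : ∀ x → (∀ z → coef x z ≈ 0#) → ∣ x ∣≐ 𝟘
  coef⇒zero x x≈0 = ≋⇒≈ᴷ {x} {ι 0ᴼ} λ z → 𝔽.trans (x≈0 z) (𝔽.sym (coef-ι0 z))

  below⇒≤ : ∀ x m → Below x m → ∣ x ∣≤ q^- m
  below⇒≤ x m x<m 𝟘       _   = tt
  below⇒≤ x m x<m (q^- n) ∣x∣ = ℤₚ.≮⇒≥ λ n<m → proj₁ (value⇒coef x n ∣x∣) (x<m n n<m)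

  -- The bound speaks only about absolute values that x is known to have, and such a value is
  -- witnessed by a first non-zero coefficient. So the induction goes upwards: if the coefficients
  -- before n vanish and the next one does not, x has order n and violates the bound.
  ≤⇒low : ∀ x m → ∣ x ∣≤ q^- m → ∀ n → + n ℤ.- + pole x ℤ.≤ m → Low (body x) n
  ≤⇒low x m ∣x∣≤ (suc n) n-p<m j j<1+n with ℕₚ.m≤n⇒m<n∨m≡n (ℕₚ.≤-pred j<1+n)
  ... | inj₁ j<n = ≤⇒low x m ∣x∣≤ n (ℤₚ.≤-trans (ℤₚ.+-monoˡ-≤ (ℤ.- + pole x) (ℤ.+≤+ (ℕₚ.n≤1+n n))) n-p<m) j j<n
  ... | inj₂ ≡.refl with body x n ≟ꟳ 0#
  ...   | yes xₙ≈0 = xₙ≈0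
  ...   | no xₙ≉0  = contradiction (∣x∣≤ (q^- (+ n ℤ.- + pole x)) (n , (xₙ≉0 , low) , ≡.refl))
    (ℤₚ.<⇒≱ (ℤₚ.<-≤-trans (ℤₚ.+-monoˡ-< (ℤ.- + pole x) (ℤ.+<+ (ℕₚ.n<1+n n))) n-p<m))
    where
    low = ≤⇒low x m ∣x∣≤ n (ℤₚ.≤-trans (ℤₚ.+-monoˡ-≤ (ℤ.- + pole x) (ℤ.+≤+ (ℕₚ.n≤1+n n))) n-p<m)

  ≤⇒below : ∀ x m → ∣ x ∣≤ q^- m → Below x m
  ≤⇒below x m ∣x∣≤ z z<m with z ℤ.+ + pole x in eq
  ... | -[1+ _ ] = 𝔽.refl
  ... | + j      = ≤⇒low x m ∣x∣≤ (suc j) (ℤₚ.≤-trans (ℤₚ.≤-reflexive (≡.trans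
    (≡.cong (λ s → ℤ.suc s ℤ.- + pole x) (≡.sym eq)) (1+i+j-j≡1+i z (+ pole x)))) (ℤₚ.i<j⇒suc[i]≤j z<m)) j (ℕₚ.n<1+n j)
    where
    1+i+j-j≡1+i : ∀ i j → (+ 1 ℤ.+ (i ℤ.+ j)) ℤ.- j ≡ + 1 ℤ.+ i
    1+i+j-j≡1+i = solve-∀

  zero⇒≤ : ∀ x r → (∀ z → coef x z ≈ 0#) → ∣ x ∣≤ r
  zero⇒≤ x r x≈0 𝟘       _   = tt
  zero⇒≤ x r x≈0 (q^- n) ∣x∣ = contradiction (x≈0 n) (proj₁ (value⇒coef x n ∣x∣))

  -- Because all members vanish below m, any non-zero coefficient of index m exhibits a member of
  -- absolute value exactly q^(-m). The maximum 𝟘 has no index and is treated separately.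
  Max : ∀ {i} {I : Set i} → (I → K) → ℤ → Set (i Level.⊔ ℓ)
  Max u m = (∃ λ i → coef (u i) m ≉ 0#) × (∀ i → Below (u i) m)

  isMaxAbs⇒max : ∀ {i} {I : Set i} (u : I → K) m → IsMaxAbs u (q^- m) → Max u m
  isMaxAbs⇒max u m ((i , ∣uᵢ∣) , ∣u∣≤) = (i , proj₁ (value⇒coef (u i) m ∣uᵢ∣)) , λ j → ≤⇒below (u j) m (∣u∣≤ j)

  max⇒isMaxAbs : ∀ {i} {I : Set i} (u : I → K) m → Max u m → IsMaxAbs u (q^- m)
  max⇒isMaxAbs u m ((i , uᵢ≉0) , u<m) = (i , coef⇒value (u i) m uᵢ≉0 (u<m i)) , λ j → below⇒≤ (u j) m (u<m j)

  isMaxAbs-𝟘⇒zero : ∀ {i} {I : Set i} (u : I → K) → IsMaxAbs u 𝟘 → ∀ i z → coef (u i) z ≈ 0#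
  -- `Below` is strict, so the coefficient of index z is reached through the bound `suc z`; this
  -- recurs throughout.
  isMaxAbs-𝟘⇒zero u (_ , ∣u∣≤) i z = ≤⇒below (u i) (ℤ.suc z) (λ { 𝟘 _ → tt ; (q^- n) ∣uᵢ∣ → ⊥-elim (∣u∣≤ i (q^- n) ∣uᵢ∣) })
    z (ℤₚ.suc[i]≤j⇒i<j ℤₚ.≤-refl)

  zero⇒isMaxAbs-𝟘 : ∀ {i} {I : Set i} (u : I → K) → I → (∀ i z → coef (u i) z ≈ 0#) → IsMaxAbs u 𝟘
  zero⇒isMaxAbs-𝟘 u i u≈0 = (i , coef⇒zero (u i) (u≈0 i)) , λ j → zero⇒≤ (u j) 𝟘 (u≈0 j)

  max-unique : ∀ {i} {I : Set i} (u : I → K) {m n} → Max u m → Max u n → m ≡ n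
  max-unique u {m} {n} ((i , uᵢ≉0) , u<m) ((j , uⱼ≉0) , u<n) = ℤₚ.≤-antisym
    (ℤₚ.≮⇒≥ λ n<m → uⱼ≉0 (u<m j n n<m)) (ℤₚ.≮⇒≥ λ m<n → uᵢ≉0 (u<n i m m<n))

  i<1+i : ∀ i → i ℤ.< ℤ.suc i
  i<1+i i = ℤₚ.suc[i]≤j⇒i<j ℤₚ.≤-refl

  i≤∣i∣ : ∀ i → i ℤ.≤ + ℤ.∣ i ∣
  i≤∣i∣ (+ _)    = ℤₚ.≤-refl
  i≤∣i∣ -[1+ _ ] = ℤ.-≤+

  ≤⇒∃+ : ∀ {i j} → i ℤ.≤ j → ∃ λ k → i ℤ.+ + k ≡ j
  ≤⇒∃+ {i} {j} i≤j = ℤ.∣ j ℤ.- i ∣ , ≡.trans (≡.cong (λ s → i ℤ.+ s) (ℤₚ.0≤i⇒+∣i∣≡i (ℤₚ.i≤j⇒0≤j-i i≤j))) (eq i j)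
    where
    eq : ∀ i j → i ℤ.+ (j ℤ.- i) ≡ j
    eq = solve-∀

  below-mono : ∀ x {m n} → m ℤ.≤ n → Below x n → Below x m
  below-mono x m≤n x<n z z<m = x<n z (ℤₚ.<-≤-trans z<m m≤n)

  below-suc : ∀ x m → Below x m → coef x m ≈ 0# → Below x (ℤ.suc m)
  below-suc x m x<m xₘ≈0 z z<1+m with z ℤₚ.≟ m
  ... | yes ≡.refl = xₘ≈0
  ... | no z≢m     = x<m z (ℤₚ.≤∧≢⇒< (ℤₚ.≮⇒≥ λ m<z → ℤₚ.<⇒≱ z<1+m (ℤₚ.i<j⇒suc[i]≤j m<z)) z≢m)

  zero-*ᴷ : ∀ x z → coef (ι 0ᴼ *ᴷ x) z ≈ 0#
  zero-*ᴷ x z = 𝔽.trans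
    (at-cong {b = 0ᴼ} (λ n → sum-zero {suc n} _ λ k → 𝔽.zeroˡ (body x (n ∸ toℕ k))) (z ℤ.+ + pole x))
    (at-0 (z ℤ.+ + pole x))

  -- Partial sums

  partialSum : (ℕ → K) → ℕ → K
  partialSum u n = sumᴷ {n} (u ∘ toℕ)

  partialSum-cong : ∀ n u v z → (∀ k → k < n → coef (u k) z ≈ coef (v k) z) → coef (partialSum u n) z ≈ coef (partialSum v n) z
  partialSum-cong zero    u v z u≈v = 𝔽.refl
  partialSum-cong (suc n) u v z u≈v = 𝔽.trans (coef-+ (u 0) (partialSum (u ∘ suc) n) z) (𝔽.trans
    (𝔽.+-cong (u≈v 0 (s≤s z≤n)) (partialSum-cong n (u ∘ suc) (v ∘ suc) z λ k k<n → u≈v (suc k) (s≤s k<n)))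
    (𝔽.sym (coef-+ (v 0) (partialSum (v ∘ suc) n) z)))

  partialSum-zero : ∀ n u z → (∀ k → k < n → coef (u k) z ≈ 0#) → coef (partialSum u n) z ≈ 0#
  partialSum-zero zero    u z u≈0 = coef-ι0 z
  partialSum-zero (suc n) u z u≈0 = 𝔽.trans (coef-+ (u 0) (partialSum (u ∘ suc) n) z) (𝔽.trans
    (𝔽.+-cong (u≈0 0 (s≤s z≤n)) (partialSum-zero n (u ∘ suc) z λ k k<n → u≈0 (suc k) (s≤s k<n)))
    (𝔽.+-identityˡ 0#))

  partialSum-tail : ∀ {N n} u z → N ≤ n → (∀ k → N ≤ k → coef (u k) z ≈ 0#) → coef (partialSum u n) z ≈ coef (partialSum u N) z
  partialSum-tail {n = n} u z z≤n u≈0 = 𝔽.trans (partialSum-zero n u z λ k _ → u≈0 k z≤n) (𝔽.sym (coef-ι0 z))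
  partialSum-tail {suc N} {suc n} u z (s≤s N≤n) u≈0 = 𝔽.trans (coef-+ (u 0) (partialSum (u ∘ suc) n) z) (𝔽.trans
    (𝔽.+-congˡ (partialSum-tail (u ∘ suc) z N≤n λ k N≤k → u≈0 (suc k) (s≤s N≤k)))
    (𝔽.sym (coef-+ (u 0) (partialSum (u ∘ suc) N) z)))

  partialSum-+ : ∀ n u v z → coef (partialSum (λ k → u k +ᴷ v k) n) z ≈ coef (partialSum u n) z +ꟳ coef (partialSum v n) z
  partialSum-+ n u v z = 𝔽.trans (coef-sum {n} (λ k → u (toℕ k) +ᴷ v (toℕ k)) z) (𝔽.trans
    (sum-cong-≋ {n} λ k → coef-+ (u (toℕ k)) (v (toℕ k)) z) (𝔽.trans
    (∑-distrib-+ {n} (λ k → coef (u (toℕ k)) z) (λ k → coef (v (toℕ k)) z))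
    (𝔽.sym (𝔽.+-cong (coef-sum {n} (u ∘ toℕ) z) (coef-sum {n} (v ∘ toℕ) z)))))

  partialSum-neg : ∀ n u z → coef (partialSum (λ k → -ᴷ u k) n) z ≈ -ꟳ coef (partialSum u n) z
  partialSum-neg n u z = 𝔽.trans (coef-sum {n} (λ k → -ᴷ u (toℕ k)) z) (𝔽.trans
    (sum-cong-≋ {n} λ k → coef-neg (u (toℕ k)) z) (𝔽.trans
    (sum-neg {n} (λ k → coef (u (toℕ k)) z))
    (𝔽.sym (𝔽.-‿cong (coef-sum {n} (u ∘ toℕ) z)))))

  partialSum-sub : ∀ n u v z → coef (partialSum (λ k → u k -ᴷ v k) n) z ≈ coef (partialSum u n) z 𝔽.- coef (partialSum v n) z
  partialSum-sub n u v z = 𝔽.trans (partialSum-+ n u (λ k → -ᴷ v k) z) (𝔽.+-congˡ (partialSum-neg n v z))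

  -- Null sequences, series and continuity

  Null : (ℕ → K) → Set ℓ
  Null a = ∀ m → ∃ λ N → ∀ n → N ≤ n → Below (a n) m

  Series : (ℕ → O → K) → (ℕ → K) → (O → K) → Set (c Level.⊔ ℓ)
  Series fs a f = ∀ m → ∃ λ N → ∀ n → N ≤ n → ∀ t → f t ≈ partialSum (λ k → a k *ᴷ fs k t) n below m

  ContinuousAt : (O → K) → O → Set (c Level.⊔ ℓ)
  ContinuousAt f x = ∀ n → ∃ λ m → ∀ y → ι x ≈ ι y below m → f x ≈ f y below n

  tendsToZero⇒null : ∀ {a} → TendsToZero a → Null a
  tendsToZero⇒null {a} a→0 m = proj₁ (a→0 m) , λ n N≤n → ≤⇒below (a n) m (proj₂ (a→0 m) n N≤n)

  null⇒tendsToZero : ∀ {a} → Null a → TendsToZero a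
  null⇒tendsToZero {a} a→0 m = proj₁ (a→0 m) , λ n N≤n → below⇒≤ (a n) m (proj₂ (a→0 m) n N≤n)

  isSum⇒series : ∀ {fs a f} → IsSum fs a f → Series fs a f
  isSum⇒series {fs} {a} {f} s m = proj₁ (s m) , λ n N≤n t → sub⇒≈below (f t) (partialSum (λ k → a k *ᴷ fs k t) n) m
    (≤⇒below (f t -ᴷ partialSum (λ k → a k *ᴷ fs k t) n) m (proj₂ (s m) n N≤n t))

  series⇒isSum : ∀ {fs a f} → Series fs a f → IsSum fs a f
  series⇒isSum {fs} {a} {f} s m = proj₁ (s m) , λ n N≤n t → below⇒≤ (f t -ᴷ partialSum (λ k → a k *ᴷ fs k t) n) m
    (≈below⇒sub (f t) (partialSum (λ k → a k *ᴷ fs k t) n) m (proj₂ (s m) n N≤n t))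

  continuous⇒at : ∀ {f} → Continuous f → ∀ x → ContinuousAt f x
  continuous⇒at {f} f-cont x n = proj₁ (f-cont x n) , λ y x≈y → sub⇒≈below (f x) (f y) n (≤⇒below (f x -ᴷ f y) n
    (proj₂ (f-cont x n) y (below⇒≤ (ι x -ᴷ ι y) _ (≈below⇒sub (ι x) (ι y) _ x≈y))))

  at⇒continuous : ∀ {f} → (∀ x → ContinuousAt f x) → Continuous f
  at⇒continuous {f} f-cont x n = proj₁ (f-cont x n) , λ y x≈y → below⇒≤ (f x -ᴷ f y) n (≈below⇒sub (f x) (f y) n
    (proj₂ (f-cont x n) y (sub⇒≈below (ι x) (ι y) _ (≤⇒below (ι x -ᴷ ι y) _ x≈y))))

  continuous-const : ∀ w → Continuous (λ _ → w)
  continuous-const w = at⇒continuous {λ _ → w} λ x n → + 0 , λ y _ z _ → 𝔽.refl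

  continuous-+ : ∀ {f g} → Continuous f → Continuous g → Continuous (λ t → f t +ᴷ g t)
  continuous-+ {f} {g} f-cont g-cont = at⇒continuous {λ t → f t +ᴷ g t} λ x n →
    let m , f≈ = continuous⇒at {f} f-cont x n
        l , g≈ = continuous⇒at {g} g-cont x n
    in m ℤ.⊔ l , λ y x≈y z z<n → 𝔽.trans (coef-+ (f x) (g x) z) (𝔽.trans (𝔽.+-cong
         (f≈ y (λ z z<m → x≈y z (ℤₚ.<-≤-trans z<m (ℤₚ.i≤i⊔j m l))) z z<n)
         (g≈ y (λ z z<l → x≈y z (ℤₚ.<-≤-trans z<l (ℤₚ.i≤j⊔i m l))) z z<n))
         (𝔽.sym (coef-+ (f y) (g y) z)))

  continuous-neg : ∀ {f} → Continuous f → Continuous (λ t → -ᴷ f t)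
  continuous-neg {f} f-cont = at⇒continuous {λ t → -ᴷ f t} λ x n →
    let m , f≈ = continuous⇒at {f} f-cont x n
    in m , λ y x≈y z z<n → 𝔽.trans (coef-neg (f x) z) (𝔽.trans (𝔽.-‿cong (f≈ y x≈y z z<n)) (𝔽.sym (coef-neg (f y) z)))

  -- The error is split as f(x)(g(x) - g(y)) + (f(x) - f(y))g(y).
  continuous-* : ∀ {f g} → Continuous f → Continuous g → Continuous (λ t → f t *ᴷ g t)
  continuous-* {f} {g} f-cont g-cont = at⇒continuous {λ t → f t *ᴷ g t} λ x n →
    -- Poles bound absolute values: f(x) costs R indices and g(y) costs P. Requiring agreement of
    -- g(x) and g(y) below -P as well lets g(y) inherit the bound of g(x).
    let P      = + pole (g x)
        R      = + pole (f x)
        m , f≈ = continuous⇒at {f} f-cont x (n ℤ.+ P)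
        l , g≈ = continuous⇒at {g} g-cont x ((n ℤ.+ R) ℤ.⊔ (ℤ.- P))
    in m ℤ.⊔ l , λ y x≈y z z<n →
      let fx≈fy = f≈ y λ z z<m → x≈y z (ℤₚ.<-≤-trans z<m (ℤₚ.i≤i⊔j m l))
          gx≈gy = g≈ y λ z z<l → x≈y z (ℤₚ.<-≤-trans z<l (ℤₚ.i≤j⊔i m l))
          gy<P : Below (g y) (ℤ.- P)
          gy<P z z<P = 𝔽.trans (𝔽.sym (gx≈gy z (ℤₚ.<-≤-trans z<P (ℤₚ.i≤j⊔i (n ℤ.+ R) (ℤ.- P))))) (below-pole (g x) z z<P)
      in 𝔽.trans
        (*-congˡ-below (f x) (g x) (g y) (ℤ.- R) (n ℤ.+ R) (below-pole (f x))
          (λ z z<n → gx≈gy z (ℤₚ.<-≤-trans z<n (ℤₚ.i≤i⊔j (n ℤ.+ R) (ℤ.- P)))) z (≡.subst (z ℤ.<_) (eqˡ n R) z<n))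
        (*-congʳ-below (g y) (f x) (f y) (n ℤ.+ P) (ℤ.- P) gy<P fx≈fy z (≡.subst (z ℤ.<_) (eqʳ n P) z<n))
    where
    eqˡ : ∀ n p → n ≡ ℤ.- p ℤ.+ (n ℤ.+ p)
    eqˡ = solve-∀
    eqʳ : ∀ n p → n ≡ (n ℤ.+ p) ℤ.+ (ℤ.- p)
    eqʳ = solve-∀

  continuous-partialSum : ∀ n (u : ℕ → O → K) → (∀ k → Continuous (u k)) → Continuous (λ t → partialSum (λ k → u k t) n)
  continuous-partialSum zero    u u-cont = continuous-const (ι 0ᴼ)
  continuous-partialSum (suc n) u u-cont = continuous-+ {u 0} {λ t → partialSum (λ k → u (suc k) t) n} (u-cont 0)
    (continuous-partialSum n (u ∘ suc) (u-cont ∘ suc))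

  -- Bounds and maxima of null sequences

  lowerBound-< : ∀ (a : ℕ → K) N → ∃ λ p → ∀ n → n < N → Below (a n) (ℤ.- + p)
  lowerBound-< a zero    = 0 , λ _ ()
  lowerBound-< a (suc N) with lowerBound-< (a ∘ suc) N
  ... | p , a<p = pole (a 0) ⊔ p , λ
    { zero _ → below-mono (a 0) (ℤₚ.neg-mono-≤ (ℤ.+≤+ (ℕₚ.m≤m⊔n (pole (a 0)) p))) (below-pole (a 0))
    ; (suc n) (s≤s n<N) → below-mono (a (suc n)) (ℤₚ.neg-mono-≤ (ℤ.+≤+ (ℕₚ.m≤n⊔m (pole (a 0)) p))) (a<p n n<N) }

  lowerBound : ∀ a → Null a → ∃ λ p → ∀ n → Below (a n) (ℤ.- + p)
  lowerBound a a→0 with a→0 (+ 0)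
  ... | N , a<0 with lowerBound-< a N
  ...   | p , a<p = p , bound
    where
    bound : ∀ n → Below (a n) (ℤ.- + p)
    bound n with n ℕₚ.<? N
    ... | yes n<N = a<p n n<N
    ... | no n≮N  = below-mono (a n) (ℤₚ.neg-mono-≤ (ℤ.+≤+ (z≤n {p}))) (a<0 n (ℕₚ.≮⇒≥ n≮N))

  search : ∀ (a : ℕ → F) N → (∀ n → n < N → a n ≈ 0#) ⊎ (∃ λ n → a n ≉ 0#)
  search a zero    = inj₁ λ _ ()
  search a (suc N) with a 0 ≟ꟳ 0#
  ... | no a₀≉0 = inj₂ (0 , a₀≉0)
  ... | yes a₀≈0 with search (a ∘ suc) N
  ...   | inj₁ a≈0        = inj₁ λ { zero _ → a₀≈0 ; (suc n) (s≤s n<N) → a≈0 n n<N }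
  ...   | inj₂ (n , aₙ≉0) = inj₂ (suc n , aₙ≉0)

  -- Starting from a lower bound of the sequence, climb one index at a time towards m. Beyond N all
  -- entries vanish below m, so each index needs a search among the first N entries only, and the
  -- first index with a non-zero coefficient is the maximum.
  below-or-max : ∀ a → Null a → ∀ m → (∀ n → Below (a n) m) ⊎ (∃ λ m′ → m′ ℤ.< m × Max a m′)
  below-or-max a a→0 m = climb (proj₁ start) z₀ (proj₂ start)
    λ n → below-mono (a n) (ℤₚ.i⊓j≤i _ m) (proj₂ (lowerBound a a→0) n)
    where
    z₀ : ℤ
    -- The minimum with m makes the distance to m a natural number, on which `climb` recurses.
    z₀ = (ℤ.- + proj₁ (lowerBound a a→0)) ℤ.⊓ m
    start : ∃ λ k → z₀ ℤ.+ + k ≡ m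
    start = ≤⇒∃+ (ℤₚ.i⊓j≤j (ℤ.- + proj₁ (lowerBound a a→0)) m)
    N = proj₁ (a→0 m)
    eq : ∀ z k → (+ 1 ℤ.+ z) ℤ.+ k ≡ z ℤ.+ (+ 1 ℤ.+ k)
    eq = solve-∀
    climb : ∀ k z → z ℤ.+ + k ≡ m → (∀ n → Below (a n) z) → (∀ n → Below (a n) m) ⊎ (∃ λ m′ → m′ ℤ.< m × Max a m′)
    climb zero    z z≡m a<z = inj₁ (≡.subst (λ m → ∀ n → Below (a n) m) (≡.trans (≡.sym (ℤₚ.+-identityʳ z)) z≡m) a<z)
    climb (suc k) z z+1+k≡m a<z with search (λ n → coef (a n) z) N
    ... | inj₂ a≉0 = inj₂ (z , z<m , a≉0 , a<z)
      where
      z<m : z ℤ.< m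
      z<m = ≡.subst (z ℤ.<_) (≡.trans (eq z (+ k)) z+1+k≡m) (ℤₚ.<-≤-trans (i<1+i z) (ℤₚ.i≤i+j (ℤ.suc z) (+ k)))
    ... | inj₁ a≈0 = climb k (ℤ.suc z) (≡.trans (eq z (+ k)) z+1+k≡m) λ n → below-suc (a n) z (a<z n) (at-z n)
      where
      z<m : z ℤ.< m
      z<m = ≡.subst (z ℤ.<_) (≡.trans (eq z (+ k)) z+1+k≡m) (ℤₚ.<-≤-trans (i<1+i z) (ℤₚ.i≤i+j (ℤ.suc z) (+ k)))
      at-z : ∀ n → coef (a n) z ≈ 0#
      at-z n with n ℕₚ.<? N
      ... | yes n<N = a≈0 n n<N
      ... | no n≮N  = proj₂ (a→0 m) n (ℕₚ.≮⇒≥ n≮N) z z<m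

  -- Truncated coefficient sequences

  truncate : ℕ → (ℕ → K) → ℕ → K
  truncate N a n with n ℕₚ.<? N
  ... | yes _ = a n
  ... | no  _ = ι 0ᴼ

  truncate-< : ∀ N a {n} → n < N → truncate N a n ≡ a n
  truncate-< N a {n} n<N with n ℕₚ.<? N
  ... | yes _  = ≡.refl
  ... | no n≮N = contradiction n<N n≮N

  truncate-≥ : ∀ N a {n} → N ≤ n → truncate N a n ≡ ι 0ᴼ
  truncate-≥ N a {n} N≤n with n ℕₚ.<? N
  ... | yes n<N = contradiction N≤n (ℕₚ.<⇒≱ n<N)
  ... | no _    = ≡.refl

  truncate-below : ∀ N a n m → Below (a n) m → Below (truncate N a n) m
  truncate-below N a n m aₙ<m with n ℕₚ.<? N
  ... | yes _ = aₙ<m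
  ... | no _  = λ z _ → coef-ι0 z

  truncate-null : ∀ N a → Null (truncate N a)
  truncate-null N a m = N , λ n N≤n z _ → 𝔽.trans (𝔽.reflexive (≡.cong (λ x → coef x z) (truncate-≥ N a N≤n))) (coef-ι0 z)

  truncate-tail : ∀ N a n (x : K) → N ≤ n → ∀ z → coef (truncate N a n *ᴷ x) z ≈ 0#
  truncate-tail N a n x N≤n z = 𝔽.trans (𝔽.reflexive (≡.cong (λ w → coef (w *ᴷ x) z) (truncate-≥ N a N≤n))) (zero-*ᴷ x z)

  -- Presents a partial sum as a function with an expansion of its own, to which the axioms of a
  -- basis apply.
  truncate-series : ∀ fs N a → Series fs (truncate N a) (λ t → partialSum (λ k → a k *ᴷ fs k t) N)
  truncate-series fs N a m = N , λ n N≤n t z _ → 𝔽.trans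
    (partialSum-cong N (λ k → a k *ᴷ fs k t) (λ k → truncate N a k *ᴷ fs k t) z λ k k<N →
      𝔽.reflexive (≡.cong (λ x → coef (x *ᴷ fs k t) z) (≡.sym (truncate-< N a k<N))))
    (𝔽.sym (partialSum-tail (λ k → truncate N a k *ᴷ fs k t) z N≤n λ k N≤k → truncate-tail N a k (fs k t) N≤k z))

  -- The ultrametric inequality, the half of the norm formula that holds for every family of
  -- integral functions.
  series-below : ∀ {fs a f} m → (∀ n t → Below (fs n t) (+ 0)) → (∀ n → Below (a n) m) → Series fs a f → ∀ t → Below (f t) m
  series-below {fs} {a} {f} m fs-int a<m f≈Σ t z z<m with f≈Σ m
  ... | N , f≈ = 𝔽.trans (f≈ N ℕₚ.≤-refl t z z<m) (partialSum-zero N (λ k → a k *ᴷ fs k t) z λ k _ →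
    below-* (a k) (fs k t) m (+ 0) (a<m k) (fs-int k t) z (≡.subst (z ℤ.<_) (≡.sym (ℤₚ.+-identityʳ m)) z<m))

  -- Perturbation of orthonormal bases

  -- Both implications of the theorem are instances of this module with the families exchanged.
  -- Continuity of `d` is a hypothesis because a basis only supplies that of `g`.
  module Perturbation
    (g d : ℕ → O → K)
    (g-integral : ∀ n t → Below (g n t) (+ 0))
    (d-integral : ∀ n t → Below (d n t) (+ 0))
    (g≈d : ∀ n t → g n t ≈ d n t below (+ 1))
    (d-continuous : ∀ n → Continuous (d n))
    (g-basis : IsOrthonormalBasis g)
    where

    open IsOrthonormalBasis g-basis

    partialSum-g≈d : ∀ (a : ℕ → K) m n t → (∀ k → Below (a k) m) →
      partialSum (λ k → a k *ᴷ g k t) n ≈ partialSum (λ k → a k *ᴷ d k t) n below ℤ.suc m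
    partialSum-g≈d a m n t a<m z z<1+m = partialSum-cong n (λ k → a k *ᴷ g k t) (λ k → a k *ᴷ d k t) z λ k _ →
      *-congˡ-below (a k) (g k t) (d k t) m (+ 1) (a<m k) (g≈d k t) z (≡.subst (z ℤ.<_) (ℤₚ.+-comm (+ 1) m) z<1+m)

    -- Replacing each `d k` by `g k` changes the sum only from index m + 1 on, because the
    -- coefficients start at m and the functions differ from index 1 on. The maximum at index m,
    -- known for `g` by its norm formula, is therefore untouched.
    max-d : ∀ f a → Null a → Series d a f → ∀ m → Max a m → Max f m
    max-d f a a→0 f≈Σ m ((n₀ , aₙ≉0) , a<m) = transfer (isMaxAbs⇒max f′ m
      (Equivalence.from (norm f′ f′-continuous (truncate N a) f′-expansion (q^- m)) (max⇒isMaxAbs (truncate N a) m a′-max)))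
      where
      N₁ N₂ N : ℕ
      -- Past N₁ no entry of `a` reaches index m, so the witness n₀ survives truncation; past N₂ the
      -- partial sums represent f up to and including index m.
      N₁ = proj₁ (a→0 (ℤ.suc m))
      N₂ = proj₁ (f≈Σ (ℤ.suc m))
      N  = N₁ ⊔ N₂
      -- A partial sum suffices, so the series Σ aₙ gₙ need not be summed in K.
      f′ : O → K
      f′ t = partialSum (λ k → a k *ᴷ g k t) N
      f′-continuous : Continuous f′
      f′-continuous = continuous-partialSum N (λ k t → a k *ᴷ g k t) λ k → continuous-* {λ _ → a k} {g k} (continuous-const (a k)) (continuous k)
      f′-expansion : IsExpansion g f′ (truncate N a)
      f′-expansion = null⇒tendsToZero {truncate N a} (truncate-null N a) , series⇒isSum {g} {truncate N a} {f′} (truncate-series g N a)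
      n₀<N : n₀ < N
      n₀<N = ℕₚ.≰⇒> λ N≤n₀ → aₙ≉0 (proj₂ (a→0 (ℤ.suc m)) n₀ (ℕₚ.≤-trans (ℕₚ.m≤m⊔n N₁ N₂) N≤n₀) m (i<1+i m))
      a′-max : Max (truncate N a) m
      a′-max = (n₀ , λ eq → aₙ≉0 (𝔽.trans (𝔽.reflexive (≡.cong (λ x → coef x m) (≡.sym (truncate-< N a n₀<N)))) eq)) ,
        λ n → truncate-below N a n m (a<m n)
      f≈f′ : ∀ t → f t ≈ f′ t below ℤ.suc m
      f≈f′ t z z<1+m = 𝔽.trans (proj₂ (f≈Σ (ℤ.suc m)) N (ℕₚ.m≤n⊔m N₁ N₂) t z z<1+m) (𝔽.sym (partialSum-g≈d a m N t a<m z z<1+m))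
      transfer : Max f′ m → Max f m
      transfer ((t , f′≉0) , f′<m) = (t , λ eq → f′≉0 (𝔽.trans (𝔽.sym (f≈f′ t m (i<1+i m))) eq)) ,
        λ t z z<m → 𝔽.trans (f≈f′ t z (ℤₚ.<-trans z<m (i<1+i m))) (f′<m t z z<m)

    -- `max-d` gives the passage from coefficients to functions. For the converse, either `a` is too
    -- small to produce the maximum of f, or it has a maximum, which `max-d` carries over to f,
    -- where maxima are unique.
    norm-d : ∀ f → Continuous f → ∀ a → IsExpansion d f a → ∀ r → IsMaxAbs f r ⇔ IsMaxAbs a r
    norm-d f _ a (a→0′ , f≈Σ′) 𝟘 = mk⇔ to from
      where
      a→0 : Null a
      a→0 = tendsToZero⇒null {a} a→0′
      f≈Σ : Series d a f
      f≈Σ = isSum⇒series {d} {a} {f} f≈Σ′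
      to : IsMaxAbs f 𝟘 → IsMaxAbs a 𝟘
      to f-max = zero⇒isMaxAbs-𝟘 a 0 a≈0
        where
        a≈0 : ∀ n z → coef (a n) z ≈ 0#
        a≈0 n z = [ (λ a<z → a<z n z (i<1+i z)) ,
          (λ (m , _ , max) → let ((t , fₜ≉0) , _) = max-d f a a→0 f≈Σ m max in
            contradiction (isMaxAbs-𝟘⇒zero f f-max t m) fₜ≉0) ]′ (below-or-max a a→0 (ℤ.suc z))
      from : IsMaxAbs a 𝟘 → IsMaxAbs f 𝟘
      from a-max = zero⇒isMaxAbs-𝟘 f 0ᴼ λ t z →
        series-below {d} {a} {f} (ℤ.suc z) d-integral (λ n z _ → isMaxAbs-𝟘⇒zero a a-max n z) f≈Σ t z (i<1+i z)
    norm-d f _ a (a→0′ , f≈Σ′) (q^- m) = mk⇔ to from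
      where
      a→0 : Null a
      a→0 = tendsToZero⇒null {a} a→0′
      f≈Σ : Series d a f
      f≈Σ = isSum⇒series {d} {a} {f} f≈Σ′
      to : IsMaxAbs f (q^- m) → IsMaxAbs a (q^- m)
      to f-max = [
        (λ a<m → contradiction (series-below {d} {a} {f} (ℤ.suc m) d-integral a<m f≈Σ t m (i<1+i m)) fₜ≉0) ,
        (λ (m′ , _ , max′) → max⇒isMaxAbs a m
          (≡.subst (Max a) (max-unique f (max-d f a a→0 f≈Σ m′ max′) max) max′)) ]′ (below-or-max a a→0 (ℤ.suc m))
        where
        max : Max f m
        max = isMaxAbs⇒max f m f-max
        t : O
        t = proj₁ (proj₁ max)
        fₜ≉0 : coef (f t) m ≉ 0#
        fₜ≉0 = proj₂ (proj₁ max)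
      from : IsMaxAbs a (q^- m) → IsMaxAbs f (q^- m)
      from a-max = max⇒isMaxAbs f m (max-d f a a→0 f≈Σ m (isMaxAbs⇒max a m a-max))

    -- The difference of two expansions expands the zero function, so the norm formula at 𝟘 kills
    -- it.
    unique-d : ∀ f → Continuous f → ∀ a b → IsExpansion d f a → IsExpansion d f b → ∀ n → a n ≈ᴷ b n
    unique-d f f-cont a b (a→0′ , f≈Σa′) (b→0′ , f≈Σb′) n = ≋⇒≈ᴷ {a n} {b n} λ z →
      x∙y⁻¹≈ε⇒x≈y _ _ (𝔽.trans (𝔽.sym (coef-sub (a n) (b n) z)) (isMaxAbs-𝟘⇒zero a-b a-b-max n z))
      where
      a→0 : Null a
      a→0 = tendsToZero⇒null {a} a→0′
      b→0 : Null b
      b→0 = tendsToZero⇒null {b} b→0′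
      f≈Σa : Series d a f
      f≈Σa = isSum⇒series {d} {a} {f} f≈Σa′
      f≈Σb : Series d b f
      f≈Σb = isSum⇒series {d} {b} {f} f≈Σb′
      a-b : ℕ → K
      a-b k = a k -ᴷ b k
      zeroFunction : O → K
      zeroFunction _ = ι 0ᴼ
      a-b→0 : Null a-b
      a-b→0 m = proj₁ (a→0 m) ⊔ proj₁ (b→0 m) , λ k N≤k → ≈below⇒sub (a k) (b k) m λ z z<m → 𝔽.trans
        (proj₂ (a→0 m) k (ℕₚ.≤-trans (ℕₚ.m≤m⊔n _ _) N≤k) z z<m)
        (𝔽.sym (proj₂ (b→0 m) k (ℕₚ.≤-trans (ℕₚ.m≤n⊔m (proj₁ (a→0 m)) _) N≤k) z z<m))
      0≈Σ : Series d a-b zeroFunction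
      0≈Σ m = proj₁ (f≈Σa m) ⊔ proj₁ (f≈Σb m) , λ k N≤k t z z<m → 𝔽.trans (coef-ι0 z) (𝔽.sym (𝔽.trans
        (partialSum-cong k (λ k → a-b k *ᴷ d k t) (λ k → (a k *ᴷ d k t) -ᴷ (b k *ᴷ d k t)) z λ k _ →
          𝔽.trans (coef-subʳ (d k t) (a k) (b k) z) (𝔽.sym (coef-sub (a k *ᴷ d k t) (b k *ᴷ d k t) z)))
        (𝔽.trans (partialSum-sub k (λ k → a k *ᴷ d k t) (λ k → b k *ᴷ d k t) z)
        (x≈y⇒x∙y⁻¹≈ε (𝔽.trans
          (𝔽.sym (proj₂ (f≈Σa m) k (ℕₚ.≤-trans (ℕₚ.m≤m⊔n _ _) N≤k) t z z<m))
          (proj₂ (f≈Σb m) k (ℕₚ.≤-trans (ℕₚ.m≤n⊔m (proj₁ (f≈Σa m)) _) N≤k) t z z<m))))))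
      a-b-max : IsMaxAbs a-b 𝟘
      a-b-max = Equivalence.to (norm-d zeroFunction (continuous-const (ι 0ᴼ)) a-b
        (null⇒tendsToZero {a-b} a-b→0 , series⇒isSum {d} {a-b} {zeroFunction} 0≈Σ) 𝟘)
        (zero⇒isMaxAbs-𝟘 zeroFunction 0ᴼ λ _ → coef-ι0)

    -- The norm formula relates maxima, and f is only known to be bounded. So argue by
    -- contradiction: a maximum of `a` at some m′ < m would also be one of f.
    g-below : ∀ f → Continuous f → ∀ a → IsExpansion g f a → ∀ m → (∀ t → Below (f t) m) → ∀ n → Below (a n) m
    g-below f f-cont a a-exp m f<m = [ (λ a<m → a<m) ,
      (λ (m′ , m′<m , max) →
        let ((t , fₜ≉0) , _) = isMaxAbs⇒max f m′ (Equivalence.from (norm f f-cont a a-exp (q^- m′)) (max⇒isMaxAbs a m′ max))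
        in contradiction (f<m t m′ m′<m) fₜ≉0) ]′ (below-or-max a (tendsToZero⇒null {a} (proj₁ a-exp)) m)

    module Approximation (p : ℕ) where

      level : ℕ → ℤ
      level k = + k ℤ.- + p

      level-suc : ∀ k → level (suc k) ≡ ℤ.suc (level k)
      level-suc k = eq (+ k) (+ p)
        where
        eq : ∀ k p → (+ 1 ℤ.+ k) ℤ.- p ≡ + 1 ℤ.+ (k ℤ.- p)
        eq = solve-∀

      level-mono : ∀ {j k} → j ≤ k → level j ℤ.≤ level k
      level-mono j≤k = ℤₚ.+-monoˡ-≤ (ℤ.- + p) (ℤ.+≤+ j≤k)

      -- Continuity is carried along because each remainder is expanded in `g` again.
      Remainder : ℕ → Set (c Level.⊔ ℓ)
      Remainder k = ∃ λ f → Continuous f × (∀ t → Below (f t) (level k))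

      -- Only finitely many terms are moved from `g` to `d` in each round, so all corrections are
      -- finite sums and no double series has to be rearranged.
      module Step {k : ℕ} (R : Remainder k) where
        f : O → K
        f = proj₁ R
        a : ℕ → K
        a = proj₁ (expansion f (proj₁ (proj₂ R)))
        a-expansion : IsExpansion g f a
        a-expansion = proj₂ (expansion f (proj₁ (proj₂ R)))
        f≈Σ : Series g a f
        f≈Σ = isSum⇒series {g} {a} {f} (proj₂ a-expansion)
        N : ℕ
        -- The discarded tail then starts at the next level, just like the error of exchanging `g`
        -- for `d`.
        N = proj₁ (f≈Σ (level (suc k)))
        a-below : ∀ n → Below (a n) (level k)
        a-below = g-below f (proj₁ (proj₂ R)) a a-expansion (level k) (proj₂ (proj₂ R))
        f′ : O → K
        f′ t = f t -ᴷ partialSum (λ n → a n *ᴷ d n t) N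
        next : Remainder (suc k)
        next = f′ ,
          continuous-+ {f} {λ t → -ᴷ partialSum (λ n → a n *ᴷ d n t) N} (proj₁ (proj₂ R))
            (continuous-neg {λ t → partialSum (λ n → a n *ᴷ d n t) N}
              (continuous-partialSum N (λ n t → a n *ᴷ d n t) λ n → continuous-* {λ _ → a n} {d n} (continuous-const (a n)) (d-continuous n))) ,
          λ t → ≈below⇒sub (f t) (partialSum (λ n → a n *ᴷ d n t) N) (level (suc k)) λ z z<1+k → 𝔽.trans
            (proj₂ (f≈Σ (level (suc k))) N ℕₚ.≤-refl t z z<1+k)
            (partialSum-g≈d a (level k) N t a-below z (≡.subst (z ℤ.<_) (level-suc k) z<1+k))
        head : ℕ → K
        head = truncate N a
        -- The cut-off N varies from round to round; padding with zeros lets all rounds be compared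
        -- at a common length n.
        f′-eq : ∀ n → N ≤ n → ∀ t z → coef (f′ t) z ≈ coef (f t) z 𝔽.- coef (partialSum (λ i → head i *ᴷ d i t) n) z
        f′-eq n N≤n t z = 𝔽.trans (coef-sub (f t) (partialSum (λ n → a n *ᴷ d n t) N) z) (𝔽.+-congˡ (𝔽.-‿cong
          (proj₂ (truncate-series d N a (ℤ.suc z)) n N≤n t z (i<1+i z))))

      module Iteration (R₀ : Remainder 0) where
        remainder : ∀ k → Remainder k
        remainder zero    = R₀
        remainder (suc k) = Step.next (remainder k)

        f : ℕ → O → K
        f k = proj₁ (remainder k)

        N : ℕ → ℕ
        N k = Step.N (remainder k)

        -- The correction to the coefficient sequence found in round k; it starts at `level k`. It
        -- has nothing to do with base-q digits.
        digit : ℕ → ℕ → K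
        digit k = Step.head (remainder k)

        approx : ℕ → ℕ → K
        approx zero    i = ι 0ᴼ
        approx (suc k) i = approx k i +ᴷ digit k i

        digit-below : ∀ k i → Below (digit k i) (level k)
        digit-below k i = truncate-below (N k) (Step.a (remainder k)) i (level k) (Step.a-below (remainder k) i)

        digit-zero : ∀ k i → N k ≤ i → ∀ z → coef (digit k i) z ≈ 0#
        digit-zero k i N≤i z = proj₂ (truncate-null (N k) (Step.a (remainder k)) (ℤ.suc z)) i N≤i z (i<1+i z)

        -- The invariant of the iteration: what remains after k rounds is f minus the combination of
        -- the `d i` with coefficients `approx k`.
        f-approx : ∀ k n → (∀ j → j < k → N j ≤ n) → ∀ t z →
          coef (f k t) z ≈ coef (f 0 t) z 𝔽.- coef (partialSum (λ i → approx k i *ᴷ d i t) n) z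
        f-approx zero n _ t z = 𝔽.sym (𝔽.trans (𝔽.+-congˡ (𝔽.trans (𝔽.-‿cong
          (partialSum-zero n (λ i → ι 0ᴼ *ᴷ d i t) z λ i _ → zero-*ᴷ (d i t) z)) -0#≈0#)) (𝔽.+-identityʳ _))
        f-approx (suc k) n N≤n t z = 𝔽.trans (Step.f′-eq (remainder k) n (N≤n k (ℕₚ.n<1+n k)) t z) (𝔽.trans
          (𝔽.+-congʳ (f-approx k n (λ j j<k → N≤n j (ℕₚ.m<n⇒m<1+n j<k)) t z)) (𝔽.trans
          (𝔽.+-assoc _ _ _) (𝔽.+-congˡ (𝔽.trans (-‿+-comm _ _) (𝔽.-‿cong (𝔽.sym (𝔽.trans
          (partialSum-cong n (λ i → approx (suc k) i *ᴷ d i t) (λ i → (approx k i *ᴷ d i t) +ᴷ (digit k i *ᴷ d i t)) z λ i _ →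
            𝔽.trans (coef-distribʳ (d i t) (approx k i) (digit k i) z) (𝔽.sym (coef-+ (approx k i *ᴷ d i t) (digit k i *ᴷ d i t) z)))
          (partialSum-+ n (λ i → approx k i *ᴷ d i t) (λ i → digit k i *ᴷ d i t) z))))))))

        approx-stable : ∀ k r i z → z ℤ.< level k → coef (approx (r ℕ.+ k) i) z ≈ coef (approx k i) z
        approx-stable k zero    i z z<k = 𝔽.refl
        approx-stable k (suc r) i z z<k = 𝔽.trans (coef-+ (approx (r ℕ.+ k) i) (digit (r ℕ.+ k) i) z) (𝔽.trans
          (𝔽.+-cong (approx-stable k r i z z<k) (digit-below (r ℕ.+ k) i z (ℤₚ.<-≤-trans z<k (level-mono (ℕₚ.m≤n+m k r)))))
          (𝔽.+-identityʳ _))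

        approx-stable-≤ : ∀ {k l} → k ≤ l → ∀ i z → z ℤ.< level k → coef (approx l i) z ≈ coef (approx k i) z
        approx-stable-≤ {k} {l} k≤l i z z<k = 𝔽.trans
          (𝔽.reflexive (≡.cong (λ l → coef (approx l i) z) (≡.sym (ℕₚ.m∸n+n≡m k≤l)))) (approx-stable k (l ∸ k) i z z<k)

        -- Later corrections do not touch the coefficient of index level j of approx (suc j) i.
        limit : ℕ → K
        limit i = T^- p · λ j → coef (approx (suc j) i) (level j)

        limit≈approx : ∀ k i → limit i ≈ approx k i below level k
        limit≈approx k i z z<k with z ℤ.+ + p in eq
        ... | + j = 𝔽.trans (𝔽.sym (approx-stable-≤ j<k i (level j) j<1+j)) (𝔽.reflexive (≡.cong (coef (approx k i)) (≡.sym z≡j)))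
          where
          z≡j : z ≡ level j
          z≡j = ≡.trans (≡.sym (i+j-j≡i z (+ p))) (≡.cong (ℤ._- + p) eq)
          j<k : j < k
          j<k = ℕₚ.≰⇒> λ k≤j → ℤₚ.<⇒≱ z<k (ℤₚ.≤-trans (level-mono k≤j) (ℤₚ.≤-reflexive (≡.sym z≡j)))
          j<1+j : level j ℤ.< level (suc j)
          j<1+j = ≡.subst (level j ℤ.<_) (≡.sym (level-suc j)) (i<1+i (level j))
        -- Such a z lies below `level 0`, where every approximation agrees with `approx 0`, which is
        -- zero.
        ... | -[1+ j ] = 𝔽.sym (𝔽.trans (approx-stable-≤ (z≤n {k}) i z z<0) (coef-ι0 z))
          where
          z<0 : z ℤ.< level 0
          z<0 = ≡.subst (ℤ._< level 0) (≡.trans (≡.cong (ℤ._- + p) (≡.sym eq)) (i+j-j≡i z (+ p))) (ℤₚ.+-monoˡ-< (ℤ.- + p) ℤ.-<+)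

        maxN : ∀ k → ∃ λ M → ∀ j → j < k → N j ≤ M
        maxN zero    = 0 , λ _ ()
        maxN (suc k) with maxN k
        ... | M , N≤M = N k ⊔ M , bound
          where
          bound : ∀ j → j < suc k → N j ≤ N k ⊔ M
          bound j j<1+k with ℕₚ.m≤n⇒m<n∨m≡n (ℕₚ.≤-pred j<1+k)
          ... | inj₁ j<k    = ℕₚ.≤-trans (N≤M j j<k) (ℕₚ.m≤n⊔m (N k) M)
          ... | inj₂ ≡.refl = ℕₚ.m≤m⊔n (N k) M

        levelAbove : ∀ m → ∃ λ k → m ℤ.≤ level k
        levelAbove m = ℤ.∣ m ∣ ℕ.+ p , ℤₚ.≤-trans (i≤∣i∣ m) (ℤₚ.≤-reflexive (≡.sym (i+j-j≡i (+ ℤ.∣ m ∣) (+ p))))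

        approx-zero : ∀ k i → (∀ j → j < k → N j ≤ i) → ∀ z → coef (approx k i) z ≈ 0#
        approx-zero zero    i _   z = coef-ι0 z
        approx-zero (suc k) i N≤i z = 𝔽.trans (coef-+ (approx k i) (digit k i) z) (𝔽.trans
          (𝔽.+-cong (approx-zero k i (λ j j<k → N≤i j (ℕₚ.m<n⇒m<1+n j<k)) z) (digit-zero k i (N≤i k (ℕₚ.n<1+n k)) z))
          (𝔽.+-identityˡ 0#))

        -- Below `level k` the limit agrees with `approx k`, which is finitely supported because
        -- every correction is.
        limit-null : Null limit
        limit-null m = proj₁ (maxN k) , λ n M≤n z z<m → 𝔽.trans (limit≈approx k n z (ℤₚ.<-≤-trans z<m m≤k))
          (approx-zero k n (λ j j<k → ℕₚ.≤-trans (proj₂ (maxN k) j j<k) M≤n) z)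
          where
          k = proj₁ (levelAbove m)
          m≤k = proj₂ (levelAbove m)

        limit-series : Series d limit (f 0)
        limit-series m = proj₁ (maxN k) , λ n M≤n t z z<m → 𝔽.trans
          (x∙y⁻¹≈ε⇒x≈y _ _ (𝔽.trans (𝔽.sym (f-approx k n (λ j j<k → ℕₚ.≤-trans (proj₂ (maxN k) j j<k) M≤n) t z))
            (proj₂ (proj₂ (remainder k)) t z (ℤₚ.<-≤-trans z<m m≤k))))
          (𝔽.sym (partialSum-cong n (λ i → limit i *ᴷ d i t) (λ i → approx k i *ᴷ d i t) z λ i _ →
            *-congʳ-below (d i t) (limit i) (approx k i) (level k) (+ 0) (d-integral i t) (limit≈approx k i) z
              (≡.subst (z ℤ.<_) (≡.sym (ℤₚ.+-identityʳ (level k))) (ℤₚ.<-≤-trans z<m m≤k))))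
          where
          k = proj₁ (levelAbove m)
          m≤k = proj₂ (levelAbove m)

    -- The iteration needs a uniform bound on f. It comes from the expansion in `g`: a null sequence
    -- is bounded, and the `g n` are integral.
    expansion-d : ∀ f → Continuous f → ∃ (IsExpansion d f)
    expansion-d f f-cont = limit , null⇒tendsToZero {limit} limit-null , series⇒isSum {d} {limit} {f} limit-series
      where
      a = proj₁ (expansion f f-cont)
      a-exp = proj₂ (expansion f f-cont)
      bound = lowerBound a (tendsToZero⇒null {a} (proj₁ a-exp))
      open Approximation (proj₁ bound)
      open Iteration (f , f-cont , λ t → ≡.subst (Below (f t)) (≡.sym (ℤₚ.+-identityˡ _))
        (series-below {g} {a} {f} _ g-integral (proj₂ bound) (isSum⇒series {g} {a} {f} (proj₂ a-exp)) t))
        using (limit; limit-null; limit-series)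

    d-basis : IsOrthonormalBasis d
    d-basis = record { continuous = d-continuous ; expansion = expansion-d ; unique = unique-d ; norm = norm-d }

  -- Wilson's theorem in a finite field

  *-cancelʳ-≉0 : ∀ {x y w} → w ≉ 0# → x *ꟳ w ≈ y *ꟳ w → x ≈ y
  *-cancelʳ-≉0 {x} {y} {w} w≉0 xw≈yw = 𝔽.trans (𝔽.sym (cancel x)) (𝔽.trans (𝔽.*-congʳ xw≈yw) (cancel y))
    where
    cancel : ∀ x → (x *ꟳ w) *ꟳ proj₁ (inverse w w≉0) ≈ x
    cancel x = 𝔽.trans (𝔽.*-assoc _ _ _) (𝔽.trans (𝔽.*-congˡ (proj₂ (inverse w w≉0))) (𝔽.*-identityʳ x))

  1≉0 : 1# ≉ 0#
  1≉0 1≈0 = 0≉1 (𝔽.sym 1≈0)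

  -1≉0 : -ꟳ 1# ≉ 0#
  -1≉0 -1≈0 = 1≉0 (-‿injective (𝔽.trans -1≈0 (𝔽.sym -0#≈0#)))

  unit-≉0 : ∀ {x y} → x *ꟳ y ≈ 1# → y ≉ 0#
  unit-≉0 {x} xy≈1 y≈0 = 1≉0 (𝔽.trans (𝔽.sym xy≈1) (𝔽.trans (𝔽.*-congˡ y≈0) (𝔽.zeroʳ x)))

  -- If u + 1 is not zero, cancel it from u(u + 1) = 1(u + 1).
  square≈1 : ∀ u → u *ꟳ u ≈ 1# → u ≈ 1# ⊎ u ≈ -ꟳ 1#
  square≈1 u u²≈1 with u +ꟳ 1# ≟ꟳ 0#
  ... | yes u+1≈0 = inj₂ (+-inverseˡ-unique u 1# u+1≈0)
  ... | no u+1≉0  = inj₁ (*-cancelʳ-≉0 u+1≉0 (𝔽.trans (𝔽.distribˡ u u 1#) (𝔽.trans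
    (𝔽.+-cong u²≈1 (𝔽.*-identityʳ u)) (𝔽.trans (𝔽.+-comm 1# u) (𝔽.sym (𝔽.*-identityˡ _))))))

  productᴸ : List F → F
  productᴸ = foldr _*ꟳ_ 1#

  productᴸ-↭ : ∀ {xs ys} → xs ↭ ys → productᴸ xs ≈ productᴸ ys
  productᴸ-↭ = foldr-commMonoid 𝔽.*-isCommutativeMonoid

  extract : ∀ {x xs} → x ∈ xs → ∃ λ ys → xs ↭ x ∷ ys
  extract {xs = y ∷ ys} (here x≈y) = ys , prep (𝔽.sym x≈y) ↭-refl
  extract {xs = y ∷ ys} (there x∈ys) with extract x∈ys
  ... | zs , ys↭x∷zs = y ∷ zs , ↭-trans (prep 𝔽.refl ys↭x∷zs) (swap 𝔽.refl 𝔽.refl ↭-refl)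

  ∈-tail : ∀ {x y ys} → x ∈ y ∷ ys → x ≉ y → x ∈ ys
  ∈-tail (here x≈y)   x≉y = contradiction x≈y x≉y
  ∈-tail (there x∈ys) x≉y = x∈ys

  -- Inverse pairs are removed one at a time. The rest of the list is obtained only up to
  -- permutation, so the recursion runs on a bound n for the length.
  productᴸ-paired : ∀ n xs → length xs ≤ n → Unique xs →
    (∀ {x} → x ∈ xs → ∃ λ y → y ∈ xs × x *ꟳ y ≈ 1# × y ≉ x) → productᴸ xs ≈ 1#
  productᴸ-paired n       []       _         _             _       = 𝔽.refl
  productᴸ-paired (suc n) (x ∷ xs) (s≤s ≤n) x∷xs!@(x∉ ∷ xs!) partner with partner (here 𝔽.refl)
  ... | y , y∈ , xy≈1 , y≉x with extract (∈-tail y∈ y≉x)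
  ...   | zs , xs↭y∷zs with Unique-resp-↭ xs↭y∷zs xs!
  ...     | y∉ ∷ zs! = 𝔽.trans (𝔽.*-congˡ (productᴸ-↭ xs↭y∷zs)) (𝔽.trans (𝔽.sym (𝔽.*-assoc x y _)) (𝔽.trans
    (𝔽.*-cong xy≈1 (productᴸ-paired n zs |zs|≤n zs! partner′)) (𝔽.*-identityˡ 1#)))
    where
    |zs|≤n : length zs ≤ n
    |zs|≤n = ℕₚ.≤-trans (ℕₚ.n≤1+n _) (≡.subst (_≤ n) (xs↭ys⇒|xs|≡|ys| xs↭y∷zs) ≤n)
    zs⊆xs : ∀ {u} → u ∈ zs → u ∈ xs
    zs⊆xs u∈zs = ∈-resp-↭ (↭-sym xs↭y∷zs) (there u∈zs)
    partner′ : ∀ {u} → u ∈ zs → ∃ λ v → v ∈ zs × u *ꟳ v ≈ 1# × v ≉ u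
    partner′ {u} u∈zs with partner (there (zs⊆xs u∈zs))
    ... | v , v∈ , uv≈1 , v≉u = v , ∈-tail (∈-resp-↭ xs↭y∷zs (∈-tail v∈ v≉x)) v≉y , uv≈1 , v≉u
      where
      v≉x : v ≉ x
      -- Inverses are unique: if the partner of u were x, then u would be y, which has been removed.
      -- The next case is symmetric.
      v≉x v≈x = All[≉]⇒∉ 𝔽.setoid y∉ (∈-resp-≈ 𝔽.setoid (*-cancelʳ-≉0 (unit-≉0 uv≈1) (𝔽.trans uv≈1
        (𝔽.sym (𝔽.trans (𝔽.*-congˡ v≈x) (𝔽.trans (𝔽.*-comm y x) xy≈1))))) u∈zs)
      v≉y : v ≉ y
      v≉y v≈y = All[≉]⇒∉ 𝔽.setoid x∉ (∈-resp-≈ 𝔽.setoid (*-cancelʳ-≉0 (unit-≉0 xy≈1) (𝔽.trans (𝔽.*-congˡ (𝔽.sym v≈y))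
        (𝔽.trans uv≈1 (𝔽.sym xy≈1)))) (zs⊆xs u∈zs))

  -- Only 1 and -1 are their own inverses. In characteristic 2 they coincide and just 1 is set
  -- aside; otherwise both are, and -1 remains as the product.
  wilson : ∀ xs → Unique xs → (∀ {x} → x ∈ xs → x ≉ 0#) → (∀ {x} → x ≉ 0# → x ∈ xs) → productᴸ xs ≈ -ꟳ 1#
  wilson xs xs! xs≉0 ∈xs with extract (∈xs 1≉0)
  ... | ys , xs↭1∷ys with Unique-resp-↭ xs↭1∷ys xs! | -ꟳ 1# ≟ꟳ 1#
  ...   | 1∉ys ∷ ys! | yes -1≈1 = 𝔽.trans (productᴸ-↭ xs↭1∷ys) (𝔽.trans (𝔽.*-identityˡ _) (𝔽.trans
    (productᴸ-paired (length ys) ys ℕₚ.≤-refl ys! partner) (𝔽.sym -1≈1)))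
    where
    partner : ∀ {u} → u ∈ ys → ∃ λ v → v ∈ ys × u *ꟳ v ≈ 1# × v ≉ u
    partner {u} u∈ys = v , ∈-tail (∈-resp-↭ xs↭1∷ys (∈xs (unit-≉0 uv≈1))) v≉1 , uv≈1 , v≉u
      where
      u≉0 : u ≉ 0#
      u≉0 = xs≉0 (∈-resp-↭ (↭-sym xs↭1∷ys) (there u∈ys))
      v    = proj₁ (inverse u u≉0)
      uv≈1 = proj₂ (inverse u u≉0)
      u≉1 : u ≉ 1#
      u≉1 u≈1 = All[≉]⇒∉ 𝔽.setoid 1∉ys (∈-resp-≈ 𝔽.setoid u≈1 u∈ys)
      v≉1 : v ≉ 1#
      v≉1 v≈1 = u≉1 (𝔽.trans (𝔽.sym (𝔽.*-identityʳ u)) (𝔽.trans (𝔽.*-congˡ (𝔽.sym v≈1)) uv≈1))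
      v≉u : v ≉ u
      v≉u v≈u with square≈1 u (𝔽.trans (𝔽.*-congˡ (𝔽.sym v≈u)) uv≈1)
      ... | inj₁ u≈1  = u≉1 u≈1
      ... | inj₂ u≈-1 = u≉1 (𝔽.trans u≈-1 -1≈1)
  ...   | 1∉ys ∷ ys! | no -1≉1 with extract (∈-tail (∈-resp-↭ xs↭1∷ys (∈xs -1≉0)) -1≉1)
  ...     | zs , ys↭-1∷zs with Unique-resp-↭ ys↭-1∷zs ys!
  ...       | -1∉zs ∷ zs! = 𝔽.trans (productᴸ-↭ xs↭1∷ys) (𝔽.trans (𝔽.*-identityˡ _) (𝔽.trans (productᴸ-↭ ys↭-1∷zs)
    (𝔽.trans (𝔽.*-congˡ (productᴸ-paired (length zs) zs ℕₚ.≤-refl zs! partner)) (𝔽.*-identityʳ (-ꟳ 1#)))))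
    where
    partner : ∀ {u} → u ∈ zs → ∃ λ v → v ∈ zs × u *ꟳ v ≈ 1# × v ≉ u
    partner {u} u∈zs = v , ∈-tail (∈-resp-↭ ys↭-1∷zs (∈-tail (∈-resp-↭ xs↭1∷ys (∈xs (unit-≉0 uv≈1))) v≉1)) v≉-1 , uv≈1 , v≉u
      where
      u∈ys : u ∈ ys
      u∈ys = ∈-resp-↭ (↭-sym ys↭-1∷zs) (there u∈zs)
      u≉0 : u ≉ 0#
      u≉0 = xs≉0 (∈-resp-↭ (↭-sym xs↭1∷ys) (there u∈ys))
      v    = proj₁ (inverse u u≉0)
      uv≈1 = proj₂ (inverse u u≉0)
      u≉1 : u ≉ 1#
      u≉1 u≈1 = All[≉]⇒∉ 𝔽.setoid 1∉ys (∈-resp-≈ 𝔽.setoid u≈1 u∈ys)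
      u≉-1 : u ≉ -ꟳ 1#
      u≉-1 u≈-1 = All[≉]⇒∉ 𝔽.setoid -1∉zs (∈-resp-≈ 𝔽.setoid u≈-1 u∈zs)
      v≉1 : v ≉ 1#
      v≉1 v≈1 = u≉1 (𝔽.trans (𝔽.sym (𝔽.*-identityʳ u)) (𝔽.trans (𝔽.*-congˡ (𝔽.sym v≈1)) uv≈1))
      v≉-1 : v ≉ -ꟳ 1#
      v≉-1 v≈-1 = u≉-1 (-‿injective (𝔽.trans (𝔽.sym (𝔽.trans (𝔽.sym (-‿distribʳ-* u 1#)) (𝔽.-‿cong (𝔽.*-identityʳ u))))
        (𝔽.trans (𝔽.*-congˡ (𝔽.sym v≈-1)) (𝔽.trans uv≈1 (𝔽.sym (-‿involutive 1#))))))
      v≉u : v ≉ u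
      v≉u v≈u with square≈1 u (𝔽.trans (𝔽.*-congˡ (𝔽.sym v≈u)) uv≈1)
      ... | inj₁ u≈1  = u≉1 u≈1
      ... | inj₂ u≈-1 = u≉-1 u≈-1

  elements-unique : Unique elements
  elements-unique = Uniqueₚ.map⁺ (≡.setoid (Fin q)) 𝔽.setoid from-injective (Unique≡ₚ.allFin⁺ q)
    where
    from-injective : ∀ {i j} → Inverse.from enumeration i ≈ Inverse.from enumeration j → i ≡ j
    from-injective {i} {j} eq = ≡.trans (≡.sym (Inverse.strictlyInverseˡ enumeration i)) (≡.trans
      (Inverse.to-cong enumeration eq) (Inverse.strictlyInverseˡ enumeration j))

  ∈-elements : ∀ x → x ∈ elements
  ∈-elements x = ∈-resp-≈ 𝔽.setoid (Inverse.strictlyInverseʳ enumeration x)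
    (∈-map⁺ (≡.setoid (Fin q)) 𝔽.setoid (Inverse.from-cong enumeration) (∈-allFin (Inverse.to enumeration x)))

  -- As y runs through the elements other than x, the differences x - y run once through the
  -- non-zero elements.
  elements-∖ : ∀ x → ∃ λ ys → elements ↭ x ∷ ys × All (x ≉_) ys × productᴸ (map (λ y → x 𝔽.- y) ys) ≈ -ꟳ 1#
  elements-∖ x with extract (∈-elements x)
  ... | ys , e↭x∷ys with Unique-resp-↭ e↭x∷ys elements-unique
  ...   | x∉ys ∷ ys! = ys , e↭x∷ys , x∉ys , wilson (map (λ y → x 𝔽.- y) ys)
    (Uniqueₚ.map⁺ 𝔽.setoid 𝔽.setoid (λ eq → -‿injective (+-cancelˡ x _ _ eq)) ys!) nonzero member
    where
    nonzero : ∀ {u} → u ∈ map (λ y → x 𝔽.- y) ys → u ≉ 0#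
    nonzero u∈ u≈0 with ∈-map⁻ 𝔽.setoid 𝔽.setoid u∈
    ... | y , y∈ys , u≈x-y = All[≉]⇒∉ 𝔽.setoid x∉ys (∈-resp-≈ 𝔽.setoid
      (𝔽.sym (x∙y⁻¹≈ε⇒x≈y x y (𝔽.trans (𝔽.sym u≈x-y) u≈0))) y∈ys)
    member : ∀ {u} → u ≉ 0# → u ∈ map (λ y → x 𝔽.- y) ys
    member {u} u≉0 = ∈-resp-≈ 𝔽.setoid x-[x-u]≈u (∈-map⁺ 𝔽.setoid 𝔽.setoid (λ eq → 𝔽.+-congˡ (𝔽.-‿cong eq))
      (∈-tail (∈-resp-↭ e↭x∷ys (∈-elements (x 𝔽.- u))) x-u≉x))
      where
      x-[x-u]≈u : x 𝔽.- (x 𝔽.- u) ≈ u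
      x-[x-u]≈u = 𝔽.trans (𝔽.+-congˡ (𝔽.trans (𝔽.sym (-‿+-comm x (-ꟳ u))) (𝔽.+-congˡ (-‿involutive u))))
        (𝔽.trans (𝔽.sym (𝔽.+-assoc x (-ꟳ x) u)) (𝔽.trans (𝔽.+-congʳ (𝔽.-‿inverseʳ x)) (𝔽.+-identityˡ u)))
      x-u≉x : x 𝔽.- u ≉ x
      x-u≉x eq = u≉0 (-‿injective (𝔽.trans (+-cancelˡ x _ _ (𝔽.trans eq (𝔽.sym (𝔽.+-identityʳ x)))) (𝔽.sym -0#≈0#)))

  -- Leading terms of the Carlitz polynomials

  -- The pair (n , x) stands for the monomial x Tⁿ.
  leading : CommutativeMonoid c ℓ
  leading = DirectProduct.commutativeMonoid ℕₚ.+-0-commutativeMonoid 𝔽.*-commutativeMonoid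

  private module L = CommutativeMonoid leading
  open Mult leading using (×-congʳ; ×-congˡ; ×-distrib-+) renaming (_×_ to _×ᴸ_)
  open Sum leading using (sum-init-last) renaming (sum to sumᴸ; sum-cong-≋ to sumᴸ-cong)
  open CommutativeSemigroupProperties L.commutativeSemigroup using (interchange; xy∙z≈xz∙y)

  -- a ≡ x Tⁿ modulo Tⁿ⁺¹, where x = 0 is allowed.
  Lead : O → L.Carrier → Set ℓ
  Lead a (n , x) = Low a n × a n ≈ x

  lead-resp : ∀ {a s t} → s L.≈ t → Lead a s → Lead a t
  lead-resp (≡.refl , x≈y) (low , top) = low , 𝔽.trans top x≈y

  lead-* : ∀ {a b s t} → Lead a s → Lead b t → Lead (a *ᴼ b) (s L.∙ t)
  lead-* {s = i , _} (a-low , a-top) (b-low , b-top) = low-* i a-low b-low , 𝔽.trans (top-* i a-low b-low) (𝔽.*-cong a-top b-top)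

  lead-1 : Lead 1ᴼ L.ε
  lead-1 = (λ _ ()) , 𝔽.refl

  lead-^ : ∀ {a s} → Lead a s → ∀ n → Lead (a ^ᴼ n) (n ×ᴸ s)
  lead-^ a-lead zero    = lead-1
  lead-^ a-lead (suc n) = lead-* a-lead (lead-^ a-lead n)

  lead-product : ∀ {n} (u : Fin n → O) s → (∀ k → Lead (u k) (s k)) → Lead (productᴼ u) (sumᴸ s)
  lead-product {zero}  u s u-lead = lead-1
  lead-product {suc n} u s u-lead = lead-* (u-lead zero) (lead-product (u ∘ suc) (s ∘ suc) (u-lead ∘ suc))

  bigᴸ : ∀ {a} {A : Set a} → (A → L.Carrier) → List A → L.Carrier
  bigᴸ h xs = foldr L._∙_ L.ε (map h xs)

  bigᴸ-cong : ∀ {a} {A : Set a} {h k : A → L.Carrier} {xs} → All (λ x → h x L.≈ k x) xs → bigᴸ h xs L.≈ bigᴸ k xs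
  bigᴸ-cong []           = L.refl
  bigᴸ-cong (h≈k ∷ h≈ks) = L.∙-cong h≈k (bigᴸ-cong h≈ks)

  bigᴸ-map-++ : ∀ {a b} {A : Set a} {B : Set b} (h : B → L.Carrier) (f : A → B) xs ys →
    bigᴸ h (map f xs ++ ys) L.≈ bigᴸ (h ∘ f) xs L.∙ bigᴸ h ys
  bigᴸ-map-++ h f []       ys = L.sym (L.identityˡ _)
  bigᴸ-map-++ h f (x ∷ xs) ys = L.trans (L.∙-congˡ {h (f x)} (bigᴸ-map-++ h f xs ys)) (L.sym (L.assoc (h (f x)) (bigᴸ (h ∘ f) xs) (bigᴸ h ys)))

  bigᴸ-cartesianProductWith : ∀ {a b d} {A : Set a} {B : Set b} {D : Set d} (h : D → L.Carrier) (f : A → B → D) xs ys →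
    bigᴸ h (cartesianProductWith f xs ys) L.≈ bigᴸ (λ x → bigᴸ (h ∘ f x) ys) xs
  bigᴸ-cartesianProductWith h f []       ys = L.refl
  bigᴸ-cartesianProductWith h f (x ∷ xs) ys = L.trans (bigᴸ-map-++ h (f x) ys _)
    (L.∙-congˡ (bigᴸ-cartesianProductWith h f xs ys))

  bigᴸ-const-∙ : ∀ {a} {A : Set a} s (h : A → L.Carrier) xs → bigᴸ (λ x → s L.∙ h x) xs L.≈ length xs ×ᴸ s L.∙ bigᴸ h xs
  bigᴸ-const-∙ s h []       = L.sym (L.identityˡ _)
  bigᴸ-const-∙ s h (x ∷ xs) = L.trans (L.∙-congˡ (bigᴸ-const-∙ s h xs)) (interchange s (h x) _ _)

  bigᴸ-const : ∀ {a} {A : Set a} s (xs : List A) → bigᴸ (λ _ → s) xs L.≈ length xs ×ᴸ s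
  bigᴸ-const s []       = L.refl
  bigᴸ-const s (x ∷ xs) = L.∙-congˡ (bigᴸ-const s xs)

  bigᴸ-× : ∀ {a} {A : Set a} n (h : A → L.Carrier) xs → bigᴸ (λ x → n ×ᴸ h x) xs L.≈ n ×ᴸ bigᴸ h xs
  bigᴸ-× zero    h []       = L.refl
  bigᴸ-× (suc n) h []       = L.trans (bigᴸ-× n h []) (L.sym (L.identityˡ _))
  bigᴸ-× n       h (x ∷ xs) = L.trans (L.∙-congˡ (bigᴸ-× n h xs)) (L.sym (×-distrib-+ (h x) (bigᴸ h xs) n))

  bigᴸ-↭ : ∀ {h : F → L.Carrier} {xs ys} → (∀ {x y} → x ≈ y → h x L.≈ h y) → xs ↭ ys → bigᴸ h xs L.≈ bigᴸ h ys
  bigᴸ-↭ h-cong xs↭ys = Permutationₚ.foldr-commMonoid L.setoid L.isCommutativeMonoid (Permutationₚ.map⁺ 𝔽.setoid L.setoid h-cong xs↭ys)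

  bigᴸ-order0 : ∀ {a} {A : Set a} (h : A → F) xs → bigᴸ (λ x → 0 , h x) xs L.≈ (0 , productᴸ (map h xs))
  bigᴸ-order0 h []       = L.refl
  bigᴸ-order0 h (x ∷ xs) = L.∙-congˡ {0 , h x} (bigᴸ-order0 h xs)

  length-cartesianProductWith : ∀ {a b d} {A : Set a} {B : Set b} {D : Set d} (f : A → B → D) xs ys →
    length (cartesianProductWith f xs ys) ≡ length xs ℕ.* length ys
  length-cartesianProductWith f []       ys = ≡.refl
  length-cartesianProductWith f (x ∷ xs) ys = ≡.trans (Listₚ.length-++ (map (f x) ys))
    (≡.cong₂ ℕ._+_ (Listₚ.length-map (f x) ys) (length-cartesianProductWith f xs ys))

  length-vectors : ∀ n → length (vectors n) ≡ q ℕ.^ n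
  length-vectors zero    = ≡.refl
  length-vectors (suc n) = ≡.trans (length-cartesianProductWith _∷_ elements (vectors n))
    (≡.cong₂ ℕ._*_ (≡.trans (Listₚ.length-map _ (allFin q)) (Listₚ.length-tabulate {n = q} _)) (length-vectors n))

  -- Each agreement of x with the polynomial contributes a factor T; the first disagreement stops
  -- the recursion. If all n coefficients agree, the next coefficient of x is left over, possibly
  -- zero. This is how the factor `x n` enters `lead-e`.
  leadTerm : ∀ {n} → O → Vec F n → L.Carrier
  leadTerm x [] = 0 , x 0
  leadTerm x (y ∷ m) with x 0 ≟ꟳ y
  ... | yes _ = (1 , 1#) L.∙ leadTerm (x ∘ suc) m
  ... | no  _ = 0 , x 0 𝔽.- y

  lead-factor : ∀ {n} x (m : Vec F n) → Lead (x -ᴼ polynomial m) (leadTerm x m)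
  lead-factor x [] = (λ _ ()) , 𝔽.trans (𝔽.+-congˡ -0#≈0#) (𝔽.+-identityʳ (x 0))
  lead-factor x (y ∷ m) with x 0 ≟ꟳ y
  ... | no _     = (λ _ ()) , 𝔽.refl
  ... | yes x₀≈y with lead-factor (x ∘ suc) m
  ...   | low , top = (λ { zero _ → x≈y⇒x∙y⁻¹≈ε x₀≈y ; (suc j) (s≤s j<n) → low j j<n }) , 𝔽.trans top (𝔽.sym (𝔽.*-identityˡ _))

  leadTerm-≈ : ∀ {n} x y (m : Vec F n) → x 0 ≈ y → leadTerm x (y ∷ m) L.≈ (1 , 1#) L.∙ leadTerm (x ∘ suc) m
  leadTerm-≈ x y m x₀≈y with x 0 ≟ꟳ y
  ... | yes _   = L.refl
  ... | no x₀≉y = contradiction x₀≈y x₀≉y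

  leadTerm-≉ : ∀ {n} x y (m : Vec F n) → x 0 ≉ y → leadTerm x (y ∷ m) L.≈ (0 , x 0 𝔽.- y)
  leadTerm-≉ x y m x₀≉y with x 0 ≟ꟳ y
  ... | yes x₀≈y = contradiction x₀≈y x₀≉y
  ... | no _     = L.refl

  leadTerm-cong : ∀ {n} x {y y′} (m : Vec F n) → y ≈ y′ → leadTerm x (y ∷ m) L.≈ leadTerm x (y′ ∷ m)
  leadTerm-cong x {y} {y′} m y≈y′ with x 0 ≟ꟳ y
  ... | yes x₀≈y = L.sym (leadTerm-≈ x y′ m (𝔽.trans x₀≈y y≈y′))
  ... | no x₀≉y  = L.trans (≡.refl , 𝔽.+-congˡ (𝔽.-‿cong y≈y′))
    (L.sym (leadTerm-≉ x y′ m λ x₀≈y′ → x₀≉y (𝔽.trans x₀≈y′ (𝔽.sym y≈y′))))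

  lead-list : ∀ {n} x (ms : List (Vec F n)) → Lead (foldr (λ m acc → (x -ᴼ polynomial m) *ᴼ acc) 1ᴼ ms) (bigᴸ (leadTerm x) ms)
  lead-list x []       = lead-1
  lead-list x (m ∷ ms) = lead-* (lead-factor x m) (lead-list x ms)

  -- The leading term -T of every bracket [k].
  -[T] : L.Carrier
  -[T] = 1 , -ꟳ 1#

  -- The monomial (-T)^(1 + q + ... + q^(n-1)), kept as a product so that passing from n to n + 1
  -- appends one factor.
  leadF : ℕ → L.Carrier
  leadF n = sumᴸ {n} λ i → (q ℕ.^ toℕ i) ×ᴸ -[T]

  leadF-suc : ∀ n → leadF (suc n) L.≈ leadF n L.∙ (q ℕ.^ n) ×ᴸ -[T]
  leadF-suc n = L.trans (sum-init-last {n} λ i → (q ℕ.^ toℕ i) ×ᴸ -[T]) (L.∙-cong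
    (sumᴸ-cong {n} λ i → ×-congˡ { -[T]} (≡.cong (q ℕ.^_) (Finₚ.toℕ-inject₁ i)))
    (×-congˡ { -[T]} (≡.cong (q ℕ.^_) (Finₚ.toℕ-fromℕ n))))

  -- With x = x₀ + T x′, the factors x - m with m(0) = x₀ are T (x′ - m′); the
  -- constant terms of the others multiply to (-1)^(qⁿ) by Wilson's theorem.
  bigᴸ-vectors-suc : ∀ n x → bigᴸ (leadTerm x) (vectors (suc n)) L.≈ (q ℕ.^ n) ×ᴸ -[T] L.∙ bigᴸ (leadTerm (x ∘ suc)) (vectors n)
  bigᴸ-vectors-suc n x with elements-∖ (x 0)
  ... | ys , e↭x₀∷ys , x₀∉ys , prod = begin
    bigᴸ (leadTerm x) (vectors (suc n))  ≈⟨ bigᴸ-cartesianProductWith (leadTerm x) _∷_ elements (vectors n) ⟩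
    bigᴸ block elements                  ≈⟨ bigᴸ-↭ {block} (λ y≈y′ → bigᴸ-cong (All.universal (λ m → leadTerm-cong x m y≈y′) (vectors n))) e↭x₀∷ys ⟩
    block (x 0) L.∙ bigᴸ block ys        ≈⟨ L.∙-cong block-≈ (bigᴸ-cong (All.map block-≉ x₀∉ys)) ⟩
    (Q ×ᴸ (1 , 1#) L.∙ rest) L.∙ bigᴸ (λ y → Q ×ᴸ (0 , x 0 𝔽.- y)) ys
      ≈⟨ L.∙-congˡ (L.trans (bigᴸ-× Q (λ y → 0 , x 0 𝔽.- y) ys) (×-congʳ Q (L.trans (bigᴸ-order0 (λ y → x 0 𝔽.- y) ys) (≡.refl , prod)))) ⟩
    (Q ×ᴸ (1 , 1#) L.∙ rest) L.∙ Q ×ᴸ (0 , -ꟳ 1#)  ≈⟨ xy∙z≈xz∙y (Q ×ᴸ (1 , 1#)) rest (Q ×ᴸ (0 , -ꟳ 1#)) ⟩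
    (Q ×ᴸ (1 , 1#) L.∙ Q ×ᴸ (0 , -ꟳ 1#)) L.∙ rest  ≈⟨ L.∙-congʳ (×-distrib-+ (1 , 1#) (0 , -ꟳ 1#) Q) ⟨
    Q ×ᴸ ((1 , 1#) L.∙ (0 , -ꟳ 1#)) L.∙ rest       ≈⟨ L.∙-congʳ (×-congʳ Q (≡.refl , 𝔽.*-identityˡ _)) ⟩
    Q ×ᴸ -[T] L.∙ rest                             ∎
    where
    open SetoidReasoning L.setoid
    Q : ℕ
    Q = q ℕ.^ n
    block : F → L.Carrier
    block y = bigᴸ (λ m → leadTerm x (y ∷ m)) (vectors n)
    rest : L.Carrier
    rest = bigᴸ (leadTerm (x ∘ suc)) (vectors n)
    block-≈ : block (x 0) L.≈ Q ×ᴸ (1 , 1#) L.∙ rest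
    block-≈ = L.trans (bigᴸ-cong (All.universal (λ m → leadTerm-≈ x (x 0) m 𝔽.refl) (vectors n)))
      (L.trans (bigᴸ-const-∙ (1 , 1#) (leadTerm (x ∘ suc)) (vectors n)) (L.∙-congʳ (×-congˡ {1 , 1#} (length-vectors n))))
    block-≉ : ∀ {y} → x 0 ≉ y → block y L.≈ Q ×ᴸ (0 , x 0 𝔽.- y)
    block-≉ {y} x₀≉y = L.trans (bigᴸ-cong (All.universal (λ m → leadTerm-≉ x y m x₀≉y) (vectors n)))
      (L.trans (bigᴸ-const (0 , x 0 𝔽.- y) (vectors n)) (×-congˡ {0 , x 0 𝔽.- y} (length-vectors n)))

  -- Both sides gain the factor (-T)^(q^n) from n to n + 1. On the left its sign comes from Wilson's
  -- theorem, on the right from the term -T of the brackets, which is why the quotient has residue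
  -- exactly `x n`.
  bigᴸ-vectors : ∀ n x → bigᴸ (leadTerm x) (vectors n) L.≈ leadF n L.∙ (0 , x n)
  bigᴸ-vectors zero    x = L.comm (0 , x 0) L.ε
  bigᴸ-vectors (suc n) x = L.trans (bigᴸ-vectors-suc n x) (L.trans (L.∙-congˡ (bigᴸ-vectors n (x ∘ suc))) (L.trans
    (L.sym (L.assoc ((q ℕ.^ n) ×ᴸ -[T]) (leadF n) (0 , x (suc n)))) (L.∙-congʳ {0 , x (suc n)} (L.trans (L.comm ((q ℕ.^ n) ×ᴸ -[T]) (leadF n)) (L.sym (leadF-suc n))))))

  lead-e : ∀ n x → Lead (e n x) (leadF n L.∙ (0 , x n))
  lead-e n x = lead-resp (bigᴸ-vectors n x) (lead-list x (vectors n))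

  lead-bracket : ∀ n → 1 ≤ n → Lead (bracket n) -[T]
  lead-bracket n 1≤n = (λ { zero _ → 𝔽.trans (𝔽.+-cong (T^-low 0 (s≤s z≤n)) -0#≈0#) (𝔽.+-identityˡ 0#) ; (suc _) (s≤s ()) }) ,
    𝔽.trans (𝔽.+-congʳ (T^-low 1 (s≤s (s≤s z≤n)))) (𝔽.+-identityˡ _)
    where
    T^-low : ∀ i → i < 2 → (T ^ᴼ (q ℕ.^ n)) i ≈ 0#
    T^-low i i<2 = proj₂ (order-T^ (q ℕ.^ n)) i (ℕₚ.<-≤-trans i<2 (2≤q^n n 1≤n))

  lead-F : ∀ n → Lead (Fᶜ n) (leadF n)
  lead-F n = lead-product {n} _ _ λ i →
    lead-^ (lead-bracket (n ∸ toℕ i) (ℕₚ.m<n⇒0<n∸m (Finₚ.toℕ<n i))) (q ℕ.^ toℕ i)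

  ×ᴸ-nonzero : ∀ n {s} → proj₂ s ≉ 0# → proj₂ (n ×ᴸ s) ≉ 0#
  ×ᴸ-nonzero zero    s≉0 = 1≉0
  ×ᴸ-nonzero (suc n) s≉0 = *-nonzero s≉0 (×ᴸ-nonzero n s≉0)

  sumᴸ-nonzero : ∀ {n} (s : Fin n → L.Carrier) → (∀ i → proj₂ (s i) ≉ 0#) → proj₂ (sumᴸ s) ≉ 0#
  sumᴸ-nonzero {zero}  s s≉0 = 1≉0
  sumᴸ-nonzero {suc n} s s≉0 = *-nonzero (s≉0 zero) (sumᴸ-nonzero (s ∘ suc) (s≉0 ∘ suc))

  leadF-nonzero : ∀ n → proj₂ (leadF n) ≉ 0#
  leadF-nonzero n = sumᴸ-nonzero {n} _ λ i → ×ᴸ-nonzero (q ℕ.^ toℕ i) -1≉0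

  -- `recip` takes the order of `Fᶜ n` from its non-vanishing proof; this identifies it with the
  -- exponent of `leadF n`.
  order-unique : ∀ {a i n x} → HasOrder a i → Lead a (n , x) → x ≉ 0# → i ≡ n
  order-unique {a} {i} {n} (aᵢ≉0 , a-low) (low , aₙ≈x) x≉0 = ℕₚ.≤-antisym
    (ℕₚ.≮⇒≥ λ n<i → x≉0 (𝔽.trans (𝔽.sym aₙ≈x) (a-low n n<i))) (ℕₚ.≮⇒≥ λ i<n → aᵢ≉0 (low i i<n))

  -- Residues modulo T

  -- Integrality and the residue modulo T in one condition: the coefficient of T^0 sits at index
  -- `pole x` of the body. Poles add under multiplication just as orders do, so residues inherit
  -- multiplicativity from `Lead`.
  Residue : K → F → Set ℓ
  Residue x r = Lead (body x) (pole x , r)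

  residue-1 : Residue (ι 1ᴼ) 1#
  residue-1 = lead-1

  residue-* : ∀ {x y r s} → Residue x r → Residue y s → Residue (x *ᴷ y) (r *ꟳ s)
  residue-* = lead-*

  residue-^ : ∀ {x r} → Residue x r → ∀ n → Residue (x ^ᴷ n) (r ^ꟳ n)
  residue-^ x-res zero    = residue-1
  residue-^ x-res (suc n) = residue-* x-res (residue-^ x-res n)

  residue-/F : ∀ n a r → Lead a (leadF n L.∙ (0 , r)) → Residue (ι a *ᴷ recip (Fᶜ n) (Fᶜ-nonZero n)) r
  residue-/F n a r a-lead with Fᶜ-nonZero n | lead-F n
  -- Abstracting the non-vanishing proof turns its order into a variable i, which can then be
  -- unified with the exponent of `leadF n`.
  ... | i , Fᵢ≉0 , F-low | F-lead with order-unique (Fᵢ≉0 , F-low) F-lead (leadF-nonzero n)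
  ...   | ≡.refl = lead-resp (≡.trans (ℕₚ.+-identityʳ _) (ℕₚ.+-identityʳ _) , coefficient) (lead-* a-lead recip-lead)
    where
    u⁻¹ : F
    u⁻¹ = proj₁ (inverse (Fᶜ n i) Fᵢ≉0)
    -- At index 0 the geometric series in `recip` has the single summand w^0 = 1.
    recip-lead : Lead (body (recip (Fᶜ n) (i , Fᵢ≉0 , F-low))) (0 , u⁻¹)
    recip-lead = (λ _ ()) , 𝔽.trans (𝔽.*-congˡ (𝔽.+-identityʳ 1#)) (𝔽.*-identityʳ u⁻¹)
    coefficient : (proj₂ (leadF n) *ꟳ r) *ꟳ u⁻¹ ≈ r
    coefficient = 𝔽.trans (𝔽.*-congʳ (𝔽.*-comm _ r)) (𝔽.trans (𝔽.*-assoc r _ u⁻¹) (𝔽.trans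
      (𝔽.*-congˡ (𝔽.trans (𝔽.*-congʳ (𝔽.sym (proj₂ F-lead))) (proj₂ (inverse (Fᶜ n i) Fᵢ≉0)))) (𝔽.*-identityʳ r)))

  residue-E : ∀ n x → Residue (E n x) (x n)
  residue-E zero    x = (λ _ ()) , 𝔽.refl
  residue-E (suc n) x = residue-/F (suc n) (e (suc n) x) (x (suc n)) (lead-e (suc n) x)

  residue-𝒟 : ∀ n x → Residue (ι (𝒟 n x)) (x n)
  residue-𝒟 n x = (λ _ ()) , 𝔽.trans (𝔽.reflexive (≡.cong (_×ꟳ x n) (nCn≡1 n))) (𝔽.+-identityʳ (x n))

  -- The product of the powers of the coefficients of x with the digits as exponents, a residue
  -- common to both families.
  digitResidue : ℕ → Expansion q → O → F
  digitResidue n []       x = 1#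
  digitResidue n (α ∷ αs) x = (x n ^ꟳ toℕ α) *ꟳ digitResidue (suc n) αs x

  residue-digitProduct : ∀ {u} → (∀ n x → Residue (u n x) (x n)) → ∀ n αs x → Residue (digitProduct u n αs x) (digitResidue n αs x)
  residue-digitProduct u-res n []       x = residue-1
  residue-digitProduct u-res n (α ∷ αs) x = residue-* (residue-^ (u-res n x) (toℕ α)) (residue-digitProduct u-res (suc n) αs x)

  residue⇒below : ∀ {x r} → Residue x r → Below x (+ 0)
  residue⇒below {x} (low , _) = Low⇒Below x (+ 0) (pole x) low ℤₚ.≤-refl

  residue⇒≈ : ∀ {x y r} → Residue x r → Residue y r → x ≈ y below (+ 1)
  residue⇒≈ {x} {y} x-res y-res (+ 0) _ = 𝔽.trans (proj₂ x-res) (𝔽.sym (proj₂ y-res))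
  residue⇒≈ {x} {y} x-res y-res (+ suc _) (ℤ.+<+ (s≤s ()))
  residue⇒≈ {x} {y} x-res y-res z@(-[1+ _ ]) _ = 𝔽.trans (residue⇒below {x} x-res z ℤ.-<+) (𝔽.sym (residue⇒below {y} y-res z ℤ.-<+))

  -- Continuity of the digit products

  -- The number s is the loss of precision: 0 for polynomials over O and n for the Hasse derivative
  -- `𝒟 n`, which moves coefficients down by n places.
  continuous-ι : ∀ (h : O → O) s → (∀ M x y → (∀ i → i < M ℕ.+ s → x i ≈ y i) → ∀ i → i < M → h x i ≈ h y i) → Continuous (λ t → ι (h t))
  continuous-ι h s h-lipschitz = at⇒continuous {λ t → ι (h t)} λ x n →
    + (ℤ.∣ n ∣ ℕ.+ s) , λ y x≈y z z<n → bound x y n z z<n (h-lipschitz ℤ.∣ n ∣ x y λ i i<M →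
      𝔽.trans (body-coef (ι x) i) (𝔽.trans
        (x≈y (+ i ℤ.- + 0) (≡.subst (ℤ._< + (ℤ.∣ n ∣ ℕ.+ s)) (≡.sym (ℤₚ.+-identityʳ (+ i))) (ℤ.+<+ i<M)))
        (𝔽.sym (body-coef (ι y) i))))
    where
    bound : ∀ x y n z → z ℤ.< n → (∀ i → i < ℤ.∣ n ∣ → h x i ≈ h y i) → coef (ι (h x)) z ≈ coef (ι (h y)) z
    bound x y n -[1+ _ ] z<n h≈ = 𝔽.refl
    bound x y (+ n) (+ j) (ℤ.+<+ j<n) h≈ = h≈ (j ℕ.+ 0) (≡.subst (_< n) (≡.sym (ℕₚ.+-identityʳ j)) j<n)

  e-cong-below : ∀ {n} (ms : List (Vec F n)) M x y → (∀ i → i < M → x i ≈ y i) → ∀ i → i < M →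
    foldr (λ m acc → (x -ᴼ polynomial m) *ᴼ acc) 1ᴼ ms i ≈ foldr (λ m acc → (y -ᴼ polynomial m) *ᴼ acc) 1ᴼ ms i
  e-cong-below []       M x y x≈y i i<M = 𝔽.refl
  e-cong-below (m ∷ ms) M x y x≈y i i<M = *ᴼ-cong-below i
    (λ j j≤i → 𝔽.+-congʳ { -ꟳ polynomial m j} (x≈y j (ℕₚ.≤-<-trans j≤i i<M)))
    (λ j j≤i → e-cong-below ms M x y x≈y j (ℕₚ.≤-<-trans j≤i i<M))

  continuous-e : ∀ n → Continuous (λ t → ι (e n t))
  continuous-e n = continuous-ι (e n) 0 λ M x y x≈y →
    e-cong-below (vectors n) M x y λ i i<M → x≈y i (≡.subst (i <_) (≡.sym (ℕₚ.+-identityʳ M)) i<M)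

  continuous-E : ∀ n → Continuous (E n)
  continuous-E zero    = continuous-ι (λ x → x) 0 λ M x y x≈y i i<M → x≈y i (≡.subst (i <_) (≡.sym (ℕₚ.+-identityʳ M)) i<M)
  continuous-E (suc n) = continuous-* {λ t → ι (e (suc n) t)} {λ _ → recip (Fᶜ (suc n)) (Fᶜ-nonZero (suc n))}
    (continuous-e (suc n)) (continuous-const (recip (Fᶜ (suc n)) (Fᶜ-nonZero (suc n))))

  continuous-𝒟 : ∀ n → Continuous (λ t → ι (𝒟 n t))
  continuous-𝒟 n = continuous-ι (𝒟 n) n λ M x y x≈y i i<M → ×ꟳ-congʳ ((i ℕ.+ n) C n) (x≈y (i ℕ.+ n) (ℕₚ.+-monoˡ-< n i<M))
    where open Mult 𝔽.+-commutativeMonoid using () renaming (×-congʳ to ×ꟳ-congʳ)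

  continuous-^ : ∀ {f} → Continuous f → ∀ n → Continuous (λ t → f t ^ᴷ n)
  continuous-^ {f} f-cont zero    = continuous-const (ι 1ᴼ)
  continuous-^ {f} f-cont (suc n) = continuous-* {f} {λ t → f t ^ᴷ n} f-cont (continuous-^ {f} f-cont n)

  continuous-digitProduct : ∀ {u} → (∀ n → Continuous (u n)) → ∀ n αs → Continuous (digitProduct u n αs)
  continuous-digitProduct     u-cont n []       = continuous-const (ι 1ᴼ)
  continuous-digitProduct {u} u-cont n (α ∷ αs) = continuous-* {λ t → u n t ^ᴷ toℕ α} {digitProduct u (suc n) αs}
    (continuous-^ {u n} (u-cont n) (toℕ α)) (continuous-digitProduct {u} u-cont (suc n) αs)

  -- Comparison of the two families

  G-residue : ∀ j x → Residue (G j x) (digitResidue 0 (digits j) x)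
  G-residue j x = residue-digitProduct {E} residue-E 0 (digits j) x

  D-residue : ∀ j x → Residue (D j x) (digitResidue 0 (digits j) x)
  D-residue j x = residue-digitProduct {λ n x → ι (𝒟 n x)} residue-𝒟 0 (digits j) x

  G-integral : ∀ j x → Below (G j x) (+ 0)
  G-integral j x = residue⇒below {G j x} (G-residue j x)

  D-integral : ∀ j x → Below (D j x) (+ 0)
  D-integral j x = residue⇒below {D j x} (D-residue j x)

  G-basis⇒D-basis : IsOrthonormalBasis G → IsOrthonormalBasis D
  G-basis⇒D-basis = Perturbation.d-basis G D G-integral D-integral
    (λ j x → residue⇒≈ {G j x} {D j x} (G-residue j x) (D-residue j x))
    (λ j → continuous-digitProduct {λ n x → ι (𝒟 n x)} continuous-𝒟 0 (digits j))

  D-basis⇒G-basis : IsOrthonormalBasis D → IsOrthonormalBasis G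
  D-basis⇒G-basis = Perturbation.d-basis D G D-integral G-integral
    (λ j x → residue⇒≈ {D j x} {G j x} (D-residue j x) (G-residue j x))
    (λ j → continuous-digitProduct {E} continuous-E 0 (digits j))

theorem6 : ∀ {c ℓ : Level} (q : ℕ) → PrimePower q → (𝔽 : FiniteField c ℓ q) →
    let open LocalField 𝔽 in IsOrthonormalBasis G ⇔ IsOrthonormalBasis D
theorem6 q _ 𝔽 = mk⇔ (G-basis⇒D-basis 𝔽) (D-basis⇒G-basis 𝔽)
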